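{- Let $G$ be a finite graph. Then $G$ is $3$-locally interval if and only if $G$ is wheel-free and $G$ contains none of the following graphs as an induced subgraph: the graphs obtained by adding an apex vertex to the long claw, to the whipping top, to $\dagger_k$ for some $k \geq 2$, or to $\ddagger_n$ for some $n \geq 3$.
   Context: For a graph $G$ and a vertex $v$, the ball $B_G(v, 3/2)$ is the subgraph of $G$ with vertex set consisting of $v$ and its neighbours, and edge set consisting of the edges $xy$ of $G$ with $d(v,x) + d(v,y) < 3$ (i.e. all edges among these vertices). A graph is an interval graph if there is a path $P$ and a map $v \mapsto P_v$ assigning to each vertex a subpath of $P$ such that $uv$ is an edge if and only if $P_u$ and $P_v$ share a vertex. $G$ is $3$-locally interval if every ball $B_G(v, 3/2)$ is an interval graph. A wheel $W_n$ ($n \geq 4$) is a cycle of length $n$ plus a vertex adjacent to all its vertices; $G$ is wheel-free if it contains no wheel $W_n$, $n\ge 4$, as an induced subgraph. Adding an apex vertex to a graph $F$ means adding a new vertex adjacent to every vertex of $F$. The named graphs: The long claw has vertices $c, a_1, a_2, a_3, b_1, b_2, b_3$ and edges $ca_i$, $a_ib_i$ ($i=1,2,3$). The whipping top consists of a path $x_1x_2x_3x_4x_5$, a vertex $y$ adjacent to all of $x_1,\dots,x_5$, and a vertex $z$ adjacent only to $x_3$. For $k \geq 2$, $\dagger_k$ consists of a path $v_1 \dots v_k$, a vertex $c$ adjacent to all $v_i$, and three further vertices $p, q, s$ with $p$ adjacent only to $v_1$, $q$ adjacent only to $v_k$, and $s$ adjacent only to $c$. For $n \geq 3$, $\ddagger_n$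 consists of a path $x_1 \dots x_n$, a vertex $u$ adjacent to $x_1, \dots, x_{n-1}$, a vertex $v$ adjacent to $x_2, \dots, x_n$, the edge $uv$, and a vertex $w$ adjacent only to $u$ and $v$. -}

module Defs where

open import Data.Nat using (ℕ; zero; suc; _≡ᵇ_; _<ᵇ_; _≤_; s≤s; z≤n)
open import Data.Fin using (Fin; toℕ)
import Data.Fin as F
open import Data.Bool using (Bool; true; false; _∨_; _∧_)
open import Data.Bool.Properties using (∨-comm)
open import Data.Maybe using (Maybe; nothing; just)
open import Data.Product using (Σ; _×_; ∃; proj₁)
open import Data.Sum using (_⊎_)
open import Relation.Binary.PropositionalEquality using (_≡_; _≢_; refl)
open import Relation.Nullary using (¬_)
open import Function.Bundles using (_⇔_)

record Graph (V : Set) : Set where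
  field
    adj    : V → V → Bool
    sym    : ∀ x y → adj x y ≡ adj y x
    irrefl : ∀ x → adj x x ≡ false
open Graph public

induce : {V : Set} → Graph V → (P : V → Set) → Graph (Σ V P)
induce G P = record
  { adj    = λ x y → adj G (proj₁ x) (proj₁ y)
  ; sym    = λ x y → sym G (proj₁ x) (proj₁ y)
  ; irrefl = λ x → irrefl G (proj₁ x) }

InBall : {V : Set} → Graph V → V → V → Set
InBall G v x = (x ≡ v) ⊎ (adj G v x ≡ true)

-- The ball B_G(v, 3/2): induced subgraph on v and its neighbours
-- (all edges of G among these vertices).
Ball : {V : Set} → (G : Graph V) → (v : V) → Graph (Σ V (InBall G v))
Ball G v = induce G (InBall G v)

-- Interval graphs: a path P with vertices 0,1,…,m-1 (i.e. Fin m), each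
-- vertex x assigned the subpath [l x, r x] (l x ≤ r x); distinct x,y
-- are adjacent iff their subpaths share a vertex.

IsInterval : {V : Set} → Graph V → Set
IsInterval {V} H =
  Σ ℕ λ m → Σ (V → Fin m) λ l → Σ (V → Fin m) λ r →
    (∀ x → l x F.≤ r x) ×
    (∀ x y → x ≢ y → (adj H x y ≡ true ⇔ (l x F.≤ r y × l y F.≤ r x)))

ThreeLocallyInterval : {n : ℕ} → Graph (Fin n) → Set
ThreeLocallyInterval {n} G = ∀ (v : Fin n) → IsInterval (Ball G v)

ContainsInduced : {W : Set} {n : ℕ} → Graph (Fin n) → Graph W → Set
ContainsInduced {W} {n} G F =
  Σ (W → Fin n) λ f →
    (∀ x y → f x ≡ f y → x ≡ y) ×
    (∀ x y → adj G (f x) (f y) ≡ adj F x y)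

suc≢ᵇ : ∀ m → (suc m ≡ᵇ m) ≡ false
suc≢ᵇ zero    = refl
suc≢ᵇ (suc m) = suc≢ᵇ m

fromGen : {V : Set} (e : V → V → Bool) → (∀ x → e x x ≡ false) → Graph V
fromGen e noloop = record
  { adj    = λ x y → e x y ∨ e y x
  ; sym    = λ x y → ∨-comm (e x y) (e y x)
  ; irrefl = λ x → lemma (e x x) (noloop x) }
  where
  lemma : ∀ b → b ≡ false → (b ∨ b) ≡ false
  lemma .false refl = refl

pathE : {k : ℕ} → Fin k → Fin k → Bool
pathE i j = suc (toℕ i) ≡ᵇ toℕ j

pathE-irr : {k : ℕ} (i : Fin k) → pathE i i ≡ false
pathE-irr i = suc≢ᵇ (toℕ i)

apex : {V : Set} → Graph V → Graph (Maybe V)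
apex {V} G = record { adj = a ; sym = s ; irrefl = i }
  where
  a : Maybe V → Maybe V → Bool
  a nothing  nothing  = false
  a nothing  (just _) = true
  a (just _) nothing  = true
  a (just x) (just y) = adj G x y
  s : ∀ x y → a x y ≡ a y x
  s nothing  nothing  = refl
  s nothing  (just _) = refl
  s (just _) nothing  = refl
  s (just x) (just y) = sym G x y
  i : ∀ x → a x x ≡ false
  i nothing  = refl
  i (just x) = irrefl G x

cycleE : (n : ℕ) → Fin n → Fin n → Bool
cycleE n i j = (suc (toℕ i) ≡ᵇ toℕ j) ∨ ((toℕ j ≡ᵇ 0) ∧ (suc (toℕ i) ≡ᵇ n))

cycleE-irr : (n : ℕ) → 4 ≤ n → (i : Fin n) → cycleE n i i ≡ false
cycleE-irr n h i = go (toℕ i) n h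
  where
  go : ∀ t n → 4 ≤ n → ((suc t ≡ᵇ t) ∨ ((t ≡ᵇ 0) ∧ (suc t ≡ᵇ n))) ≡ false
  go zero    (suc (suc (suc (suc n)))) (s≤s (s≤s (s≤s (s≤s z≤n)))) = refl
  go (suc t) n h with suc≢ᵇ t
  ... | p rewrite p = refl

cycle : (n : ℕ) → 4 ≤ n → Graph (Fin n)
cycle n h = fromGen (cycleE n) (cycleE-irr n h)

wheel : (n : ℕ) → 4 ≤ n → Graph (Maybe (Fin n))
wheel n h = apex (cycle n h)

data LCV : Set where
  c : LCV
  a : Fin 3 → LCV
  b : Fin 3 → LCV

lcE : LCV → LCV → Bool
lcE c     (a _) = true
lcE (a i) (b j) = toℕ i ≡ᵇ toℕ j
lcE _     _     = false

longClaw : Graph LCV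
longClaw = fromGen lcE λ { c → refl ; (a _) → refl ; (b _) → refl }

data WTV : Set where
  x : Fin 5 → WTV
  y : WTV
  z : WTV

wtE : WTV → WTV → Bool
wtE (x i) (x j) = pathE i j
wtE y     (x _) = true
wtE z     (x i) = toℕ i ≡ᵇ 2
wtE _     _     = false

whippingTop : Graph WTV
whippingTop = fromGen wtE λ { (x i) → pathE-irr i ; y → refl ; z → refl }

data DagV (k : ℕ) : Set where
  v : Fin k → DagV k
  c : DagV k
  p : DagV k
  q : DagV k
  s : DagV k

dagE : (k : ℕ) → DagV k → DagV k → Bool
dagE k (v i) (v j) = pathE i j
dagE k c     (v _) = true
dagE k p     (v i) = toℕ i ≡ᵇ 0
dagE k q     (v i) = suc (toℕ i) ≡ᵇ k
dagE k s     c     = true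
dagE k _     _     = false

dagger : (k : ℕ) → Graph (DagV k)
dagger k = fromGen (dagE k)
  λ { (v i) → pathE-irr i ; c → refl ; p → refl ; q → refl ; s → refl }

data DDagV (n : ℕ) : Set where
  x : Fin n → DDagV n
  u : DDagV n
  v : DDagV n
  w : DDagV n

ddagE : (n : ℕ) → DDagV n → DDagV n → Bool
ddagE n (x i) (x j) = pathE i j
ddagE n u     (x i) = suc (toℕ i) <ᵇ n
ddagE n v     (x i) = 0 <ᵇ toℕ i
ddagE n u     v     = true
ddagE n w     u     = true
ddagE n w     v     = true
ddagE n _     _     = false

ddagger : (n : ℕ) → Graph (DDagV n)
ddagger n = fromGen (ddagE n)
  λ { (x i) → pathE-irr i ; u → refl ; v → refl ; w → refl }

WheelFree : {n : ℕ} → Graph (Fin n) → Set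
WheelFree G = ∀ m (h : 4 ≤ m) → ¬ ContainsInduced G (wheel m h)

{-# OPTIONS --safe #-}
{-
A ball is a vertex v joined to its neighbourhood, so it is an interval graph if and only if the
neighbourhood U is, and the theorem is the Lekkerkerker–Boland characterisation of interval graphs
applied to U.

An interval graph has no asteroidal triple, since of three disjoint intervals the middle one meets
every path between the outer two; a similar argument excludes cycles of length at least 4.

For the converse, take an asteroidal triple x, a, b in a graph without long induced cycles such that
the paths from x to a and to b have the least total length. If both are long, their ends show a long
claw, a whipping top or a dagger; if one or both have length 2, the path from a to b shows a whipping
top, a long claw, a dagger or a double dagger. Hence there is no asteroidal triple.

An interval model is then built by recursion, for a set H and a clique K whose intervals must contain
the left end, subject to: no a, b such that K reaches a avoiding the closed neighbourhood of b and
reaches b avoiding that of a. Choose t not adjacent to all of H so that K reaches as much as possible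
avoiding t, and then x not adjacent to t so that the component P of t in H minus the closed
neighbourhood of x is largest. The neighbourhood Q of P in H is a clique, and by the choice of t and x
the rest R of H misses P and is complete to Q, while K misses P. So a model of R, with K ∩ R at the
left end, is continued by a model of P ∪ Q, with Q at the left end.
-}
module Submission where

open import Defs hiding (sym; c; a; b; x; y; z; v; p; q; s; u; w)
open import Data.Nat using (ℕ; zero; suc; _+_; _∸_; _≤_; _<_; z≤n; s≤s; _≡ᵇ_; _<ᵇ_; _≤ᵇ_; _≤?_; _<?_)
open import Data.Nat.Properties
open import Data.Nat.Induction using (<-wellFounded)
open import Data.Fin using (Fin; zero; suc; toℕ; fromℕ; fromℕ<; inject₁)
import Data.Fin.Properties as Fin
open import Data.Fin.Induction using (<-weakInduction)
open import Data.Fin.Subset using (∣_∣; _∈_)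
open import Data.Fin.Subset.Properties using (p⊂q⇒∣p∣<∣q∣; ∣p∣≤n)
open import Data.Vec using (tabulate)
open import Data.Vec.Properties using (lookup∘tabulate; []=⇒lookup; lookup⇒[]=)
open import Data.Bool using (Bool; true; false; _∨_; _∧_; T)
open import Data.Bool.Properties using (∨-comm; ∨-identityʳ)
import Data.Bool.Properties as Bool
open import Data.Maybe using (Maybe; nothing; just)
open import Data.Maybe.Properties using (just-injective)
open import Data.Empty using (⊥; ⊥-elim)
open import Data.Product using (Σ; _×_; ∃; _,_; proj₁; proj₂)
open import Data.Sum using (_⊎_; inj₁; inj₂; [_,_]′)
open import Relation.Nullary using (¬_; Dec; yes; no; does)
open import Relation.Nullary.Decidable using (_×-dec_; _⊎-dec_; ¬?; decidable-stable; dec-true)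
open import Relation.Unary using (Decidable)
open import Relation.Binary using (tri<; tri≈; tri>)
open import Relation.Binary.PropositionalEquality
open import Axiom.UniquenessOfIdentityProofs using (module Decidable⇒UIP)
open Decidable⇒UIP Bool._≟_ using () renaming (≡-irrelevant to Bool-irrelevant)
open import Function.Base using (_∘_; case_of_)
open import Function.Bundles using (_⇔_; mk⇔; Equivalence)
open import Induction.WellFounded using (Acc; acc)

-- Booleans and comparisons of natural numbers.

bool-ext : ∀ {b c : Bool} → (b ≡ true → c ≡ true) → (c ≡ true → b ≡ true) → b ≡ c
bool-ext {true}  {c} f g = sym (f refl)
bool-ext {false} {true} f g = g refl
bool-ext {false} {false} f g = refl

≡ᵇ-true : ∀ {i j} → i ≡ j → (i ≡ᵇ j) ≡ true
≡ᵇ-true {zero} refl = refl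
≡ᵇ-true {suc i} refl = ≡ᵇ-true {i} refl

≡ᵇ-false : ∀ {i j} → i ≢ j → (i ≡ᵇ j) ≡ false
≡ᵇ-false {i} {j} i≢j with i ≡ᵇ j in eq
... | true = ⊥-elim (i≢j (≡ᵇ⇒≡ i j (subst T (sym eq) _)))
... | false = refl

≡ᵇ-elim : ∀ {i j} → (i ≡ᵇ j) ≡ true → i ≡ j
≡ᵇ-elim {i} {j} eq = ≡ᵇ⇒≡ i j (subst T (sym eq) _)

<ᵇ-true : ∀ {i j} → i < j → (i <ᵇ j) ≡ true
<ᵇ-true {i} {j} i<j with i <ᵇ j in eq
... | true = refl
... | false = ⊥-elim (subst T eq (<⇒<ᵇ i<j))

<ᵇ-false : ∀ {i j} → ¬ i < j → (i <ᵇ j) ≡ false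
<ᵇ-false {i} {j} i≮j with i <ᵇ j in eq
... | true = ⊥-elim (i≮j (<ᵇ⇒< i j (subst T (sym eq) _)))
... | false = refl

T≢F : ∀ {b : Bool} → b ≡ true → b ≡ false → ⊥
T≢F refl ()

¬true⇒false : ∀ {b : Bool} → ¬ b ≡ true → b ≡ false
¬true⇒false {true} ne = ⊥-elim (ne refl)
¬true⇒false {false} _ = refl

-- Walks and induced paths

module Walks {V : Set} (E : V → V → Set) where

  data Walk (S : V → Set) : V → V → ℕ → Set where
    stop : ∀ {a} → S a → Walk S a a 0
    step : ∀ {a b c k} → S a → E a b → Walk S b c k → Walk S a c (suc k)

  Conn : (S : V → Set) → V → V → Set
  Conn S a b = ∃ λ k → Walk S a b k

  module _ {S : V → Set} where

    start∈ : ∀ {a b k} → Walk S a b k → S a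
    start∈ (stop s) = s
    start∈ (step s _ _) = s

    end∈ : ∀ {a b k} → Walk S a b k → S b
    end∈ (stop s) = s
    end∈ (step _ _ w) = end∈ w

    _++_ : ∀ {a b c k l} → Walk S a b k → Walk S b c l → Walk S a c (k + l)
    stop _ ++ w = w
    step s e v ++ w = step s e (v ++ w)

    snoc : ∀ {a b c k} → Walk S a b k → E b c → S c → Walk S a c (suc k)
    snoc (stop s) e t = step s e (stop t)
    snoc (step s e w) f t = step s e (snoc w f t)

    module _ (E-sym : ∀ {x y} → E x y → E y x) where

      reverse : ∀ {a b k} → Walk S a b k → Walk S b a k
      reverse (stop s) = stop s
      reverse (step s e w) = snoc (reverse w) (E-sym e) s

    -- Indices beyond the length give the end vertex, so every value lies in `S` without a bound on
    -- the index.
    at : ∀ {a b k} → Walk S a b k → ℕ → V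
    at {a} (stop _) _ = a
    at {a} (step _ _ _) zero = a
    at (step _ _ w) (suc i) = at w i

    at-start : ∀ {a b k} (w : Walk S a b k) → at w 0 ≡ a
    at-start (stop _) = refl
    at-start (step _ _ _) = refl

    at-end : ∀ {a b k} (w : Walk S a b k) → at w k ≡ b
    at-end (stop _) = refl
    at-end (step _ _ w) = at-end w

    at∈ : ∀ {a b k} (w : Walk S a b k) i → S (at w i)
    at∈ (stop s) _ = s
    at∈ (step s _ _) zero = s
    at∈ (step _ _ w) (suc i) = at∈ w i

    at-step : ∀ {a b k} (w : Walk S a b k) {i} → i < k → E (at w i) (at w (suc i))
    at-step (step s e w) {zero} _ rewrite at-start w = e
    at-step (step s e w) {suc i} (s≤s i<k) = at-step w i<k

  map-walk : ∀ {S T : V → Set} → (∀ {x} → S x → T x) → ∀ {a b k} → Walk S a b k → Walk T a b k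
  map-walk f (stop s) = stop (f s)
  map-walk f (step s e w) = step (f s) e (map-walk f w)

  -- Each vertex of the walk is reached from `a` by an initial piece of it, so `T` may be derived
  -- from being connected to `a` inside `S`. This is what allows arguments about whole components.
  relocate : ∀ {S T : V → Set} {a b k} → Walk S a b k → (∀ {x} → Conn S a x → T x) → Walk T a b k
  relocate (stop s) f = stop (f (0 , stop s))
  relocate (step s e w) f = step (f (0 , stop s)) e (relocate w λ (k , v) → f (suc k , step s e v))

  along : ∀ {S : V → Set} (p : ℕ → V) i d →
    (∀ j → i ≤ j → j ≤ i + d → S (p j)) →
    (∀ j → i ≤ j → j < i + d → E (p j) (p (suc j))) → Walk S (p i) (p (i + d)) d
  along p i zero ∈S st rewrite +-identityʳ i = stop (∈S i ≤-refl ≤-refl)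
  along p i (suc d) ∈S st rewrite +-suc i d =
    step (∈S i ≤-refl (m≤n⇒m≤1+n (m≤m+n i d))) (st i ≤-refl (s≤s (m≤m+n i d)))
      (along p (suc i) d (λ j i<j → ∈S j (<⇒≤ i<j)) (λ j i<j → st j (<⇒≤ i<j)))

  segment : ∀ {S : V → Set} (p : ℕ → V) {i j} → i ≤ j →
    (∀ l → i ≤ l → l ≤ j → S (p l)) →
    (∀ l → i ≤ l → l < j → E (p l) (p (suc l))) → Walk S (p i) (p j) (j ∸ i)
  segment {S} p {i} {j} i≤j ∈S st =
    subst (λ m → Walk S (p i) (p m) (j ∸ i)) (m+[n∸m]≡n i≤j)
      (along p i (j ∸ i) (λ l i≤l l≤ → ∈S l i≤l (≤-trans l≤ (≤-reflexive (m+[n∸m]≡n i≤j))))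
        (λ l i≤l l< → st l i≤l (≤-trans l< (≤-reflexive (m+[n∸m]≡n i≤j)))))

≡ᵇ-sym : ∀ i j → (i ≡ᵇ j) ≡ (j ≡ᵇ i)
≡ᵇ-sym zero zero = refl
≡ᵇ-sym zero (suc j) = refl
≡ᵇ-sym (suc i) zero = refl
≡ᵇ-sym (suc i) (suc j) = ≡ᵇ-sym i j

∨-split : ∀ (b : Bool) {c} → b ∨ c ≡ true → b ≡ true ⊎ c ≡ true
∨-split true _ = inj₁ refl
∨-split false eq = inj₂ eq

∨-introˡ : ∀ {b c : Bool} → b ≡ true → b ∨ c ≡ true
∨-introˡ refl = refl

∨-introʳ : ∀ (b : Bool) {c} → c ≡ true → b ∨ c ≡ true
∨-introʳ true _ = refl
∨-introʳ false eq = eq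

-- `cycleE` on natural numbers, which permits splitting on the index.
cyc : ℕ → ℕ → ℕ → Bool
cyc m i j = (suc i ≡ᵇ j) ∨ ((j ≡ᵇ 0) ∧ (suc i ≡ᵇ m))

cons : {V : Set} → V → (ℕ → V) → ℕ → V
cons v p zero = v
cons v p (suc i) = p i

module InGraph {n : ℕ} (G : Graph (Fin n)) where

  V : Set
  V = Fin n

  E : V → V → Set
  E x y = adj G x y ≡ true

  E? : ∀ x y → Dec (E x y)
  E? x y = adj G x y Bool.≟ true

  E-sym : ∀ {x y} → E x y → E y x
  E-sym {x} {y} e = trans (Graph.sym G y x) e

  E-irrefl : ∀ {x} → ¬ E x x
  E-irrefl {x} e = T≢F e (irrefl G x)

  E⇒≢ : ∀ {x y} → E x y → x ≢ y
  E⇒≢ e refl = E-irrefl e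

  ¬E-sym : ∀ {x y} → ¬ E x y → ¬ E y x
  ¬E-sym ne e = ne (E-sym e)

  non : ∀ {x y} → ¬ E x y → adj G x y ≡ false
  non = ¬true⇒false

  open Walks E public

  -- Only the values up to `N` are constrained; a total `p` lets a piece of the path be taken by
  -- shifting the index.
  record IPath (p : ℕ → V) (N : ℕ) : Set where
    field
      link : ∀ {i} → i < N → E (p i) (p (suc i))
      far  : ∀ {i j} → suc i < j → j ≤ N → ¬ E (p i) (p j)
      dist : ∀ {i j} → i < j → j ≤ N → p i ≢ p j
  open IPath public

  module _ {p : ℕ → V} {N : ℕ} (P : IPath p N) where

    inj-path : ∀ {i j} → i ≤ N → j ≤ N → p i ≡ p j → i ≡ j
    inj-path {i} {j} i≤N j≤N eq with <-cmp i j
    ... | tri< i<j _ _ = ⊥-elim (dist P i<j j≤N eq)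
    ... | tri≈ _ i≡j _ = i≡j
    ... | tri> _ _ j<i = ⊥-elim (dist P j<i i≤N (sym eq))

    nbr : ∀ {i j} → i ≤ N → j ≤ N → E (p i) (p j) → suc i ≡ j ⊎ suc j ≡ i
    nbr {i} {j} i≤N j≤N e with <-cmp i j
    nbr {i} {j} i≤N j≤N e | tri< i<j _ _ with m≤n⇒m<n∨m≡n i<j
    ... | inj₁ si<j = ⊥-elim (far P si<j j≤N e)
    ... | inj₂ si≡j = inj₁ si≡j
    nbr i≤N j≤N e | tri≈ _ refl _ = ⊥-elim (E-irrefl e)
    nbr {i} {j} i≤N j≤N e | tri> _ _ j<i with m≤n⇒m<n∨m≡n j<i
    ... | inj₁ sj<i = ⊥-elim (far P sj<i i≤N (E-sym e))
    ... | inj₂ sj≡i = inj₂ sj≡i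

    next : ∀ {i j} → i < j → j ≤ N → E (p i) (p j) → j ≡ suc i
    next i<j j≤N e with m≤n⇒m<n∨m≡n i<j
    ... | inj₁ si<j = ⊥-elim (far P si<j j≤N e)
    ... | inj₂ si≡j = sym si≡j

    adj-path : ∀ {i j} → i ≤ N → j ≤ N → adj G (p i) (p j) ≡ (suc i ≡ᵇ j) ∨ (suc j ≡ᵇ i)
    adj-path {i} {j} i≤N j≤N = bool-ext
      (λ e → [ (λ eq → cong (_∨ (suc j ≡ᵇ i)) (≡ᵇ-true {suc i} {j} eq))
             , (λ eq → ∨-introʳ (suc i ≡ᵇ j) (≡ᵇ-true {suc j} {i} eq)) ]′ (nbr i≤N j≤N e))
      (λ eq → [ (λ t → case ≡ᵇ-elim {suc i} {j} t of λ { refl → link P j≤N })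
              , (λ t → case ≡ᵇ-elim {suc j} {i} t of λ { refl → E-sym (link P i≤N) }) ]′
              (∨-split (suc i ≡ᵇ j) eq))

    far′ : ∀ {i j} → suc i < j → j ≤ N → ¬ E (p j) (p i)
    far′ i<j j≤N = ¬E-sym (far P i<j j≤N)

    -- Every vertex of a path with at least one edge has a neighbour on that path.
    off-path : ∀ {s} → 1 ≤ N → (∀ {i} → i ≤ N → ¬ E s (p i)) → ∀ {i} → i ≤ N → s ≢ p i
    off-path 1≤N s≁ {zero} i≤N refl = s≁ 1≤N (link P 1≤N)
    off-path 1≤N s≁ {suc i} i≤N refl = s≁ (<⇒≤ i≤N) (E-sym (link P i≤N))

    -- The offset stands on the right so that `l + i` computes for numerals `l`, as in the
    -- five-vertex path of a long claw.
    sub-path : ∀ i {M} → M + i ≤ N → IPath (λ l → p (l + i)) M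
    sub-path i {M} h = record
      { link = λ l<M → link P (≤-trans (+-monoˡ-≤ i l<M) h)
      ; far  = λ l<l′ l′≤M → far P (+-monoˡ-≤ i l<l′) (≤-trans (+-monoˡ-≤ i l′≤M) h)
      ; dist = λ l<l′ l′≤M → dist P (+-monoˡ-≤ i l<l′) (≤-trans (+-monoˡ-≤ i l′≤M) h) }

    cons-path : ∀ {v} → E v (p 0) → (∀ {i} → 0 < i → i ≤ N → ¬ E v (p i)) →
      (∀ {i} → i ≤ N → v ≢ p i) → IPath (cons v p) (suc N)
    cons-path {v} v~ v≁ v≢ = record { link = lk ; far = fr ; dist = ds }
      where
      lk : ∀ {i} → i < suc N → E (cons v p i) (cons v p (suc i))
      lk {zero} _ = v~
      lk {suc i} (s≤s h) = link P h
      fr : ∀ {i j} → suc i < j → j ≤ suc N → ¬ E (cons v p i) (cons v p j)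
      fr {zero} {suc j} (s≤s h) (s≤s k) = v≁ h k
      fr {suc i} {suc j} (s≤s h) (s≤s k) = far P h k
      ds : ∀ {i j} → i < j → j ≤ suc N → cons v p i ≢ cons v p j
      ds {zero} {suc j} _ (s≤s k) = v≢ k
      ds {suc i} {suc j} (s≤s h) (s≤s k) = dist P h k

  five : (v₀ v₁ v₂ v₃ v₄ : V) → ℕ → V
  five v₀ v₁ v₂ v₃ v₄ = cons v₀ (cons v₁ (cons v₂ (cons v₃ (λ _ → v₄))))

  -- Non-consecutive vertices are distinct because in each such pair one has a neighbour on the path
  -- that the other lacks.
  five-path : ∀ {v₀ v₁ v₂ v₃ v₄} → E v₀ v₁ → E v₁ v₂ → E v₂ v₃ → E v₃ v₄ →
    ¬ E v₀ v₂ → ¬ E v₀ v₃ → ¬ E v₀ v₄ → ¬ E v₁ v₃ → ¬ E v₁ v₄ → ¬ E v₂ v₄ →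
    IPath (five v₀ v₁ v₂ v₃ v₄) 4
  five-path {v₀} {v₁} {v₂} {v₃} {v₄} e₀₁ e₁₂ e₂₃ e₃₄ n₀₂ n₀₃ n₀₄ n₁₃ n₁₄ n₂₄ = record
    { link = lk
    ; far = λ {i} {j} h k → fr i j (≤⇒≤ᵇ h) (≤⇒≤ᵇ k)
    ; dist = λ {i} {j} h k → ds i j (≤⇒≤ᵇ h) (≤⇒≤ᵇ k) }
    where
    f = five v₀ v₁ v₂ v₃ v₄
    big : ∀ {i} → ¬ (5 + i ≤ 4)
    big (s≤s (s≤s (s≤s (s≤s ()))))
    lk : ∀ {i} → i < 4 → E (f i) (f (suc i))
    lk {0} _ = e₀₁
    lk {1} _ = e₁₂
    lk {2} _ = e₂₃
    lk {3} _ = e₃₄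
    lk {suc (suc (suc (suc i)))} h = ⊥-elim (big h)
    -- The bounds are Boolean so that pairs of numerals out of range are absurd by evaluation.
    fr : ∀ i j → T (2 + i ≤ᵇ j) → T (j ≤ᵇ 4) → ¬ E (f i) (f j)
    fr 0 2 _ _ = n₀₂
    fr 0 3 _ _ = n₀₃
    fr 0 4 _ _ = n₀₄
    fr 1 3 _ _ = n₁₃
    fr 1 4 _ _ = n₁₄
    fr 2 4 _ _ = n₂₄
    fr (suc (suc (suc i))) j h k = ⊥-elim (big (≤-trans (≤ᵇ⇒≤ (5 + i) j h) (≤ᵇ⇒≤ j 4 k)))
    ds : ∀ i j → T (1 + i ≤ᵇ j) → T (j ≤ᵇ 4) → f i ≢ f j
    ds 0 1 _ _ = E⇒≢ e₀₁
    ds 0 2 _ _ refl = n₀₃ e₂₃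
    ds 0 3 _ _ refl = n₁₃ (E-sym e₀₁)
    ds 0 4 _ _ refl = n₁₄ (E-sym e₀₁)
    ds 1 2 _ _ = E⇒≢ e₁₂
    ds 1 3 _ _ refl = n₁₄ e₃₄
    ds 1 4 _ _ refl = n₀₄ e₀₁
    ds 2 3 _ _ = E⇒≢ e₂₃
    ds 2 4 _ _ refl = n₁₄ e₁₂
    ds 3 4 _ _ = E⇒≢ e₃₄
    ds (suc (suc (suc (suc i)))) j h k = ⊥-elim (big (≤-trans (≤ᵇ⇒≤ (5 + i) j h) (≤ᵇ⇒≤ j 4 k)))

  Induced : (V → Set) → V → V → ℕ → Set
  Induced S x y k = Σ (ℕ → V) λ p → p 0 ≡ x × p k ≡ y × (∀ i → S (p i)) × IPath p k

  module _ {S : V → Set} where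

    take : ∀ {x y k} (w : Walk S x y k) {i} → i ≤ k → Walk S x (at w i) i
    take (stop s) z≤n = stop s
    take (step s e w) z≤n = stop s
    take (step s e w) (s≤s h) = step s e (take w h)

    drop : ∀ {x y k} (w : Walk S x y k) {i} → i ≤ k → Walk S (at w i) y (k ∸ i)
    drop (stop s) z≤n = stop s
    drop (step s e w) z≤n = step s e w
    drop (step s e w) (s≤s h) = drop w h

    -- A chord or a repeated vertex would allow a shortcut, whose length `gain` and `gain′` bound.
    shortest : ∀ {x y k} → Walk S x y k → (∀ {l} → l < k → ¬ Walk S x y l) → Induced S x y k
    shortest {x} {y} {k} w min = at w , at-start w , at-end w , at∈ w , record
      { link = at-step w
      ; far = λ {i} {j} si<j j≤k e → min (gain si<j j≤k)
          (take w (≤-trans (<⇒≤ (<⇒≤ si<j)) j≤k) ++ step (at∈ w i) e (drop w j≤k))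
      ; dist = λ {i} {j} i<j j≤k eq → min (gain′ i<j j≤k)
          (take w (≤-trans (<⇒≤ i<j) j≤k) ++ subst (λ t → Walk S t y (k ∸ j)) (sym eq) (drop w j≤k)) }
      where
      gain′ : ∀ {i j} → i < j → j ≤ k → i + (k ∸ j) < k
      gain′ {i} {j} i<j j≤k = ≤-trans (+-monoˡ-< (k ∸ j) i<j) (≤-reflexive (m+[n∸m]≡n j≤k))
      gain : ∀ {i j} → suc i < j → j ≤ k → i + suc (k ∸ j) < k
      gain {i} {j} h j≤k = subst (_< k) (sym (+-suc i (k ∸ j))) (gain′ h j≤k)

    -- With `⊥` as the goal, the induction hypothesis itself refutes every shorter walk, so the walk
    -- at hand may be taken to be shortest without a search.
    by-shortest : ∀ {x y} → Conn S x y → (∀ {k} → Induced S x y k → ⊥) → ⊥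
    by-shortest {x} {y} (k , w) f = go k (<-wellFounded k) w
      where
      go : ∀ k → Acc _<_ k → Walk S x y k → ⊥
      go k (acc rec) w = f (shortest w λ l<k v → go _ (rec l<k) v)

  -- Copies of the forbidden graphs

  Copy : {W : Set} → (V → Set) → Graph W → Set
  Copy {W} U F = Σ (W → V) λ f → (∀ t → U (f t)) ×
    (∀ t t′ → f t ≡ f t′ → t ≡ t′) × (∀ t t′ → adj G (f t) (f t′) ≡ adj F t t′)

  module _ {W : Set} (rank : W → ℕ) (f : W → V) where

    -- Injectivity and matching are symmetric in the two vertices, so one order of ranks suffices.
    -- The Boolean comparison makes most pairs in the other order absurd by evaluation.
    wlog-inj : (∀ t t′ → T (rank t ≤ᵇ rank t′) → f t ≡ f t′ → t ≡ t′) →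
      ∀ t t′ → f t ≡ f t′ → t ≡ t′
    wlog-inj h t t′ eq with ≤-total (rank t) (rank t′)
    ... | inj₁ r = h t t′ (≤⇒≤ᵇ r) eq
    ... | inj₂ r = sym (h t′ t (≤⇒≤ᵇ r) (sym eq))

    wlog-match : (e : W → W → Bool) →
      (∀ t t′ → T (rank t ≤ᵇ rank t′) → adj G (f t) (f t′) ≡ e t t′ ∨ e t′ t) →
      ∀ t t′ → adj G (f t) (f t′) ≡ e t t′ ∨ e t′ t
    wlog-match e h t t′ with ≤-total (rank t) (rank t′)
    ... | inj₁ r = h t t′ (≤⇒≤ᵇ r)
    ... | inj₂ r = trans (Graph.sym G _ _) (trans (h t′ t (≤⇒≤ᵇ r)) (∨-comm (e t′ t) _))

  module _ {U : V → Set} where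

    module _ {p : ℕ → V} {N : ℕ} (P : IPath p N) (p∈U : ∀ {i} → i ≤ N → U (p i))
      (2≤N : 2 ≤ N) {d : V} (d∈U : U d) (d~start : E d (p 0)) (d~end : E d (p N))
      (d≁ : ∀ {i} → 0 < i → i < N → ¬ E d (p i)) (d≢ : ∀ {i} → i ≤ N → d ≢ p i) where

      private
        f : ℕ → V
        f = cons d p

        nbr-d : ∀ j → j ≤ N → adj G d (p j) ≡ ((0 ≡ᵇ j) ∨ false) ∨ (j ≡ᵇ N)
        nbr-d zero _ = d~start
        nbr-d (suc j) h with m≤n⇒m<n∨m≡n h
        ... | inj₁ j<N = trans (non (d≁ (s≤s z≤n) j<N)) (sym (≡ᵇ-false {suc j} {N} (<⇒≢ j<N)))
        ... | inj₂ refl = trans d~end (sym (≡ᵇ-true {j} refl))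

        match : ∀ i j → i ≤ suc N → j ≤ suc N → adj G (f i) (f j) ≡ cyc (2 + N) i j ∨ cyc (2 + N) j i
        match zero zero _ _ = irrefl G d
        match zero (suc j) _ (s≤s h) = nbr-d j h
        match (suc i) zero (s≤s h) _ = trans (Graph.sym G (p i) d)
          (trans (nbr-d i h) (∨-comm ((0 ≡ᵇ i) ∨ false) (i ≡ᵇ N)))
        match (suc i) (suc j) (s≤s h) (s≤s k) = trans (adj-path P h k)
          (sym (cong₂ _∨_ (∨-identityʳ (suc i ≡ᵇ j)) (∨-identityʳ (suc j ≡ᵇ i))))

        distinct : ∀ i j → i ≤ suc N → j ≤ suc N → f i ≡ f j → i ≡ j
        distinct zero zero _ _ _ = refl
        distinct zero (suc j) _ (s≤s h) eq = ⊥-elim (d≢ h eq)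
        distinct (suc i) zero (s≤s h) _ eq = ⊥-elim (d≢ h (sym eq))
        distinct (suc i) (suc j) (s≤s h) (s≤s k) eq = cong suc (inj-path P h k eq)

        f∈U : ∀ i → i ≤ suc N → U (f i)
        f∈U zero _ = d∈U
        f∈U (suc i) (s≤s h) = p∈U h

      cycle-copy : Copy U (cycle (2 + N) (s≤s (s≤s 2≤N)))
      cycle-copy = (λ i → f (toℕ i)) , (λ i → f∈U _ (bd i))
        , (λ i j eq → Fin.toℕ-injective (distinct _ _ (bd i) (bd j) eq))
        , (λ i j → match _ _ (bd i) (bd j))
        where
        bd : ∀ (i : Fin (2 + N)) → toℕ i ≤ suc N
        bd i = ≤-pred (Fin.toℕ<n i)

    module _ {q : ℕ → V} {k : ℕ} (Q : IPath q (suc k)) (q∈U : ∀ {i} → i ≤ suc k → U (q i))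
      (2≤k : 2 ≤ k) {c s : V} (c∈U : U c) (s∈U : U s) (c~s : E c s)
      (s≁ : ∀ {i} → i ≤ suc k → ¬ E s (q i)) (c≁first : ¬ E c (q 0)) (c≁last : ¬ E c (q (suc k)))
      (c~ : ∀ {i} → 1 ≤ i → i ≤ k → E c (q i)) where

      private
        f : DagV k → V
        f (Defs.v i) = q (suc (toℕ i))
        f DagV.c = c
        f DagV.p = q 0
        f DagV.q = q (suc k)
        f DagV.s = s

        rank : DagV k → ℕ
        rank (Defs.v _) = 0
        rank DagV.c = 1
        rank DagV.p = 2
        rank DagV.q = 3
        rank DagV.s = 4

        bd : ∀ (i : Fin k) → suc (toℕ i) ≤ suc k
        bd i = m≤n⇒m≤1+n (Fin.toℕ<n i)

        c≢ : ∀ {i} → i ≤ suc k → c ≢ q i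
        c≢ h refl = s≁ h (E-sym c~s)

        s≢ : ∀ {i} → i ≤ suc k → s ≢ q i
        s≢ = off-path Q (s≤s z≤n) s≁

        f∈U : ∀ t → U (f t)
        f∈U (Defs.v i) = q∈U (bd i)
        f∈U DagV.c = c∈U
        f∈U DagV.p = q∈U z≤n
        f∈U DagV.q = q∈U ≤-refl
        f∈U DagV.s = s∈U

        v≢q : ∀ (i : Fin k) → q (suc (toℕ i)) ≢ q (suc k)
        v≢q i = dist Q (s≤s (Fin.toℕ<n i)) ≤-refl

        distinct : ∀ t t′ → T (rank t ≤ᵇ rank t′) → f t ≡ f t′ → t ≡ t′
        distinct (Defs.v i) (Defs.v j) _ eq = cong Defs.v (Fin.toℕ-injective (suc-injective (inj-path Q (bd i) (bd j) eq)))
        distinct (Defs.v i) DagV.c _ eq = ⊥-elim (c≢ (bd i) (sym eq))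
        distinct (Defs.v i) DagV.p _ eq = ⊥-elim (dist Q (s≤s z≤n) (bd i) (sym eq))
        distinct (Defs.v i) DagV.q _ eq = ⊥-elim (v≢q i eq)
        distinct (Defs.v i) DagV.s _ eq = ⊥-elim (s≢ (bd i) (sym eq))
        distinct DagV.c DagV.c _ eq = refl
        distinct DagV.c DagV.p _ eq = ⊥-elim (c≢ z≤n eq)
        distinct DagV.c DagV.q _ eq = ⊥-elim (c≢ ≤-refl eq)
        distinct DagV.c DagV.s _ eq = ⊥-elim (E⇒≢ c~s eq)
        distinct DagV.p DagV.p _ eq = refl
        distinct DagV.p DagV.q _ eq = ⊥-elim (dist Q (s≤s z≤n) ≤-refl eq)
        distinct DagV.p DagV.s _ eq = ⊥-elim (s≢ z≤n (sym eq))
        distinct DagV.q DagV.q _ eq = refl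
        distinct DagV.q DagV.s _ eq = ⊥-elim (s≢ ≤-refl (sym eq))
        distinct DagV.s DagV.s _ eq = refl

        v-q : ∀ (i : Fin k) → adj G (q (suc (toℕ i))) (q (suc k)) ≡ (suc (toℕ i) ≡ᵇ k)
        v-q i = trans (adj-path Q (bd i) ≤-refl)
          (trans (cong ((suc (toℕ i) ≡ᵇ k) ∨_) (≡ᵇ-false {suc k} {toℕ i} λ eq → <⇒≢ (bd i) (sym eq)))
                 (∨-identityʳ _))

        match : ∀ t t′ → T (rank t ≤ᵇ rank t′) → adj G (f t) (f t′) ≡ dagE k t t′ ∨ dagE k t′ t
        match (Defs.v i) (Defs.v j) _ = adj-path Q (bd i) (bd j)
        match (Defs.v i) DagV.c _ = E-sym (c~ (s≤s z≤n) (Fin.toℕ<n i))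
        match (Defs.v i) DagV.p _ = trans (adj-path Q (bd i) z≤n) (≡ᵇ-sym 0 (toℕ i))
        match (Defs.v i) DagV.q _ = v-q i
        match (Defs.v i) DagV.s _ = non (¬E-sym (s≁ (bd i)))
        match DagV.c DagV.c _ = irrefl G c
        match DagV.c DagV.p _ = non c≁first
        match DagV.c DagV.q _ = non c≁last
        match DagV.c DagV.s _ = c~s
        match DagV.p DagV.p _ = irrefl G _
        match DagV.p DagV.q _ = non (far Q (s≤s (≤-trans (s≤s z≤n) 2≤k)) ≤-refl)
        match DagV.p DagV.s _ = non (¬E-sym (s≁ z≤n))
        match DagV.q DagV.q _ = irrefl G _
        match DagV.q DagV.s _ = non (¬E-sym (s≁ ≤-refl))
        match DagV.s DagV.s _ = irrefl G _

      -- The ends of the path `q` become the pendant vertices of the dagger, and its `k` inner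
      -- vertices become the path joined to `c`.
      dagger-copy : Copy U (dagger k)
      dagger-copy = f , f∈U , wlog-inj rank f distinct , wlog-match rank f (dagE k) match

    module _ {q : ℕ → V} {M : ℕ} (Q : IPath q M) (q∈U : ∀ {i} → i ≤ M → U (q i))
      (1≤M : 1 ≤ M) {u v w : V} (u∈U : U u) (v∈U : U v) (w∈U : U w)
      (u~v : E u v) (w~u : E w u) (w~v : E w v) (w≁ : ∀ {i} → i ≤ M → ¬ E w (q i))
      (u~ : ∀ {i} → i < M → E u (q i)) (u≁last : ¬ E u (q M))
      (v≁first : ¬ E v (q 0)) (v~ : ∀ {i} → 0 < i → i ≤ M → E v (q i)) where

      private
        f : DDagV (suc M) → V
        f (DDagV.x i) = q (toℕ i)
        f DDagV.u = u
        f DDagV.v = v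
        f DDagV.w = w

        rank : DDagV (suc M) → ℕ
        rank (DDagV.x _) = 0
        rank DDagV.u = 1
        rank DDagV.v = 2
        rank DDagV.w = 3

        bd : ∀ (i : Fin (suc M)) → toℕ i ≤ M
        bd i = ≤-pred (Fin.toℕ<n i)

        f∈U : ∀ t → U (f t)
        f∈U (DDagV.x i) = q∈U (bd i)
        f∈U DDagV.u = u∈U
        f∈U DDagV.v = v∈U
        f∈U DDagV.w = w∈U

        distinct : ∀ t t′ → T (rank t ≤ᵇ rank t′) → f t ≡ f t′ → t ≡ t′
        distinct (DDagV.x i) (DDagV.x j) _ eq = cong DDagV.x (Fin.toℕ-injective (inj-path Q (bd i) (bd j) eq))
        distinct (DDagV.x i) DDagV.u _ eq = ⊥-elim (w≁ (bd i) (subst (E w) (sym eq) w~u))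
        distinct (DDagV.x i) DDagV.v _ eq = ⊥-elim (w≁ (bd i) (subst (E w) (sym eq) w~v))
        distinct (DDagV.x i) DDagV.w _ eq = ⊥-elim (off-path Q 1≤M w≁ (bd i) (sym eq))
        distinct DDagV.u DDagV.u _ _ = refl
        distinct DDagV.u DDagV.v _ eq = ⊥-elim (E⇒≢ u~v eq)
        distinct DDagV.u DDagV.w _ eq = ⊥-elim (E⇒≢ w~u (sym eq))
        distinct DDagV.v DDagV.v _ _ = refl
        distinct DDagV.v DDagV.w _ eq = ⊥-elim (E⇒≢ w~v (sym eq))
        distinct DDagV.w DDagV.w _ _ = refl

        x-u : ∀ i → i ≤ M → adj G (q i) u ≡ (i <ᵇ M)
        x-u i h with m≤n⇒m<n∨m≡n h
        ... | inj₁ i<M = trans (E-sym (u~ i<M)) (sym (<ᵇ-true i<M))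
        ... | inj₂ refl = trans (non (¬E-sym u≁last)) (sym (<ᵇ-false (<-irrefl {i} refl)))

        x-v : ∀ i → i ≤ M → adj G (q i) v ≡ (0 <ᵇ i)
        x-v zero _ = non (¬E-sym v≁first)
        x-v (suc i) h = E-sym (v~ (s≤s z≤n) h)

        match : ∀ t t′ → T (rank t ≤ᵇ rank t′) → adj G (f t) (f t′) ≡ ddagE (suc M) t t′ ∨ ddagE (suc M) t′ t
        match (DDagV.x i) (DDagV.x j) _ = adj-path Q (bd i) (bd j)
        match (DDagV.x i) DDagV.u _ = x-u (toℕ i) (bd i)
        match (DDagV.x i) DDagV.v _ = x-v (toℕ i) (bd i)
        match (DDagV.x i) DDagV.w _ = non (¬E-sym (w≁ (bd i)))
        match DDagV.u DDagV.u _ = irrefl G _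
        match DDagV.u DDagV.v _ = u~v
        match DDagV.u DDagV.w _ = E-sym w~u
        match DDagV.v DDagV.v _ = irrefl G _
        match DDagV.v DDagV.w _ = E-sym w~v
        match DDagV.w DDagV.w _ = irrefl G _

      ddagger-copy : Copy U (ddagger (suc M))
      ddagger-copy = f , f∈U , wlog-inj rank f distinct , wlog-match rank f (ddagE (suc M)) match

    module _ {q : ℕ → V} (Q : IPath q 4) (q∈U : ∀ {i} → i ≤ 4 → U (q i)) {e f : V} (e∈U : U e) (f∈U : U f)
      (e~₂ : E e (q 2)) (e≁₀ : ¬ E e (q 0)) (e≁₁ : ¬ E e (q 1)) (e≁₃ : ¬ E e (q 3)) (e≁₄ : ¬ E e (q 4))
      (e~f : E e f) (f≁ : ∀ {i} → i ≤ 4 → ¬ E f (q i)) where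

      private
        g : LCV → V
        g (LCV.b zero) = q 0
        g (LCV.a zero) = q 1
        g LCV.c = q 2
        g (LCV.a (suc zero)) = q 3
        g (LCV.b (suc zero)) = q 4
        g (LCV.a (suc (suc zero))) = e
        g (LCV.b (suc (suc zero))) = f

        rank : LCV → ℕ
        rank (LCV.b zero) = 0
        rank (LCV.a zero) = 1
        rank LCV.c = 2
        rank (LCV.a (suc zero)) = 3
        rank (LCV.b (suc zero)) = 4
        rank (LCV.a (suc (suc zero))) = 5
        rank (LCV.b (suc (suc zero))) = 6

        g∈U : ∀ t → U (g t)
        g∈U (LCV.b zero) = q∈U (≤ᵇ⇒≤ 0 4 _)
        g∈U (LCV.a zero) = q∈U (≤ᵇ⇒≤ 1 4 _)
        g∈U LCV.c = q∈U (≤ᵇ⇒≤ 2 4 _)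
        g∈U (LCV.a (suc zero)) = q∈U (≤ᵇ⇒≤ 3 4 _)
        g∈U (LCV.b (suc zero)) = q∈U (≤ᵇ⇒≤ 4 4 _)
        g∈U (LCV.a (suc (suc zero))) = e∈U
        g∈U (LCV.b (suc (suc zero))) = f∈U

        e≢ : ∀ {i} → i ≤ 4 → e ≢ q i
        e≢ h refl = f≁ h (E-sym e~f)

        f≢ : ∀ {i} → i ≤ 4 → f ≢ q i
        f≢ = off-path Q (s≤s z≤n) f≁

        distinct : ∀ t t′ → T (rank t ≤ᵇ rank t′) → g t ≡ g t′ → t ≡ t′
        distinct (LCV.b zero) (LCV.b zero) _ _ = refl
        distinct (LCV.b zero) (LCV.a zero) _ eq = ⊥-elim (dist Q (≤ᵇ⇒≤ 1 1 _) (≤ᵇ⇒≤ 1 4 _) eq)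
        distinct (LCV.b zero) LCV.c _ eq = ⊥-elim (dist Q (≤ᵇ⇒≤ 1 2 _) (≤ᵇ⇒≤ 2 4 _) eq)
        distinct (LCV.b zero) (LCV.a (suc zero)) _ eq = ⊥-elim (dist Q (≤ᵇ⇒≤ 1 3 _) (≤ᵇ⇒≤ 3 4 _) eq)
        distinct (LCV.b zero) (LCV.b (suc zero)) _ eq = ⊥-elim (dist Q (≤ᵇ⇒≤ 1 4 _) (≤ᵇ⇒≤ 4 4 _) eq)
        distinct (LCV.b zero) (LCV.a (suc (suc zero))) _ eq = ⊥-elim (e≢ (≤ᵇ⇒≤ 0 4 _) (sym eq))
        distinct (LCV.b zero) (LCV.b (suc (suc zero))) _ eq = ⊥-elim (f≢ (≤ᵇ⇒≤ 0 4 _) (sym eq))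
        distinct (LCV.a zero) (LCV.a zero) _ _ = refl
        distinct (LCV.a zero) LCV.c _ eq = ⊥-elim (dist Q (≤ᵇ⇒≤ 2 2 _) (≤ᵇ⇒≤ 2 4 _) eq)
        distinct (LCV.a zero) (LCV.a (suc zero)) _ eq = ⊥-elim (dist Q (≤ᵇ⇒≤ 2 3 _) (≤ᵇ⇒≤ 3 4 _) eq)
        distinct (LCV.a zero) (LCV.b (suc zero)) _ eq = ⊥-elim (dist Q (≤ᵇ⇒≤ 2 4 _) (≤ᵇ⇒≤ 4 4 _) eq)
        distinct (LCV.a zero) (LCV.a (suc (suc zero))) _ eq = ⊥-elim (e≢ (≤ᵇ⇒≤ 1 4 _) (sym eq))
        distinct (LCV.a zero) (LCV.b (suc (suc zero))) _ eq = ⊥-elim (f≢ (≤ᵇ⇒≤ 1 4 _) (sym eq))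
        distinct LCV.c LCV.c _ _ = refl
        distinct LCV.c (LCV.a (suc zero)) _ eq = ⊥-elim (dist Q (≤ᵇ⇒≤ 3 3 _) (≤ᵇ⇒≤ 3 4 _) eq)
        distinct LCV.c (LCV.b (suc zero)) _ eq = ⊥-elim (dist Q (≤ᵇ⇒≤ 3 4 _) (≤ᵇ⇒≤ 4 4 _) eq)
        distinct LCV.c (LCV.a (suc (suc zero))) _ eq = ⊥-elim (e≢ (≤ᵇ⇒≤ 2 4 _) (sym eq))
        distinct LCV.c (LCV.b (suc (suc zero))) _ eq = ⊥-elim (f≢ (≤ᵇ⇒≤ 2 4 _) (sym eq))
        distinct (LCV.a (suc zero)) (LCV.a (suc zero)) _ _ = refl
        distinct (LCV.a (suc zero)) (LCV.b (suc zero)) _ eq = ⊥-elim (dist Q (≤ᵇ⇒≤ 4 4 _) (≤ᵇ⇒≤ 4 4 _) eq)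
        distinct (LCV.a (suc zero)) (LCV.a (suc (suc zero))) _ eq = ⊥-elim (e≢ (≤ᵇ⇒≤ 3 4 _) (sym eq))
        distinct (LCV.a (suc zero)) (LCV.b (suc (suc zero))) _ eq = ⊥-elim (f≢ (≤ᵇ⇒≤ 3 4 _) (sym eq))
        distinct (LCV.b (suc zero)) (LCV.b (suc zero)) _ _ = refl
        distinct (LCV.b (suc zero)) (LCV.a (suc (suc zero))) _ eq = ⊥-elim (e≢ (≤ᵇ⇒≤ 4 4 _) (sym eq))
        distinct (LCV.b (suc zero)) (LCV.b (suc (suc zero))) _ eq = ⊥-elim (f≢ (≤ᵇ⇒≤ 4 4 _) (sym eq))
        distinct (LCV.a (suc (suc zero))) (LCV.a (suc (suc zero))) _ _ = refl
        distinct (LCV.a (suc (suc zero))) (LCV.b (suc (suc zero))) _ eq = ⊥-elim (E⇒≢ e~f eq)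
        distinct (LCV.b (suc (suc zero))) (LCV.b (suc (suc zero))) _ _ = refl
        distinct (LCV.b (suc (suc zero))) (LCV.a (suc (suc zero))) ()

        match : ∀ t t′ → T (rank t ≤ᵇ rank t′) → adj G (g t) (g t′) ≡ lcE t t′ ∨ lcE t′ t
        match (LCV.b zero) (LCV.b zero) _ = irrefl G _
        match (LCV.b zero) (LCV.a zero) _ = adj-path Q (≤ᵇ⇒≤ 0 4 _) (≤ᵇ⇒≤ 1 4 _)
        match (LCV.b zero) LCV.c _ = adj-path Q (≤ᵇ⇒≤ 0 4 _) (≤ᵇ⇒≤ 2 4 _)
        match (LCV.b zero) (LCV.a (suc zero)) _ = adj-path Q (≤ᵇ⇒≤ 0 4 _) (≤ᵇ⇒≤ 3 4 _)
        match (LCV.b zero) (LCV.b (suc zero)) _ = adj-path Q (≤ᵇ⇒≤ 0 4 _) (≤ᵇ⇒≤ 4 4 _)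
        match (LCV.b zero) (LCV.a (suc (suc zero))) _ = non (¬E-sym e≁₀)
        match (LCV.b zero) (LCV.b (suc (suc zero))) _ = non (¬E-sym (f≁ (≤ᵇ⇒≤ 0 4 _)))
        match (LCV.a zero) (LCV.a zero) _ = irrefl G _
        match (LCV.a zero) LCV.c _ = adj-path Q (≤ᵇ⇒≤ 1 4 _) (≤ᵇ⇒≤ 2 4 _)
        match (LCV.a zero) (LCV.a (suc zero)) _ = adj-path Q (≤ᵇ⇒≤ 1 4 _) (≤ᵇ⇒≤ 3 4 _)
        match (LCV.a zero) (LCV.b (suc zero)) _ = adj-path Q (≤ᵇ⇒≤ 1 4 _) (≤ᵇ⇒≤ 4 4 _)
        match (LCV.a zero) (LCV.a (suc (suc zero))) _ = non (¬E-sym e≁₁)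
        match (LCV.a zero) (LCV.b (suc (suc zero))) _ = non (¬E-sym (f≁ (≤ᵇ⇒≤ 1 4 _)))
        match LCV.c LCV.c _ = irrefl G _
        match LCV.c (LCV.a (suc zero)) _ = adj-path Q (≤ᵇ⇒≤ 2 4 _) (≤ᵇ⇒≤ 3 4 _)
        match LCV.c (LCV.b (suc zero)) _ = adj-path Q (≤ᵇ⇒≤ 2 4 _) (≤ᵇ⇒≤ 4 4 _)
        match LCV.c (LCV.a (suc (suc zero))) _ = E-sym e~₂
        match LCV.c (LCV.b (suc (suc zero))) _ = non (¬E-sym (f≁ (≤ᵇ⇒≤ 2 4 _)))
        match (LCV.a (suc zero)) (LCV.a (suc zero)) _ = irrefl G _
        match (LCV.a (suc zero)) (LCV.b (suc zero)) _ = adj-path Q (≤ᵇ⇒≤ 3 4 _) (≤ᵇ⇒≤ 4 4 _)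
        match (LCV.a (suc zero)) (LCV.a (suc (suc zero))) _ = non (¬E-sym e≁₃)
        match (LCV.a (suc zero)) (LCV.b (suc (suc zero))) _ = non (¬E-sym (f≁ (≤ᵇ⇒≤ 3 4 _)))
        match (LCV.b (suc zero)) (LCV.b (suc zero)) _ = irrefl G _
        match (LCV.b (suc zero)) (LCV.a (suc (suc zero))) _ = non (¬E-sym e≁₄)
        match (LCV.b (suc zero)) (LCV.b (suc (suc zero))) _ = non (¬E-sym (f≁ (≤ᵇ⇒≤ 4 4 _)))
        match (LCV.a (suc (suc zero))) (LCV.a (suc (suc zero))) _ = irrefl G _
        match (LCV.a (suc (suc zero))) (LCV.b (suc (suc zero))) _ = e~f
        match (LCV.b (suc (suc zero))) (LCV.b (suc (suc zero))) _ = irrefl G _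
        match (LCV.b (suc (suc zero))) (LCV.a (suc (suc zero))) ()

      -- The centre is `q 2`; two legs run along the path and the third through `e` to `f`.
      longClaw-copy : Copy U longClaw
      longClaw-copy = g , g∈U , wlog-inj rank g distinct , wlog-match rank g lcE match

    module _ {q : ℕ → V} (Q : IPath q 4) (q∈U : ∀ {i} → i ≤ 4 → U (q i)) {y z : V} (y∈U : U y) (z∈U : U z)
      (y~ : ∀ {i} → i ≤ 4 → E y (q i)) (z≁y : ¬ E z y)
      (z~₂ : E z (q 2)) (z≁₀ : ¬ E z (q 0)) (z≁₁ : ¬ E z (q 1)) (z≁₃ : ¬ E z (q 3)) (z≁₄ : ¬ E z (q 4)) where

      private
        g : WTV → V
        g (WTV.x i) = q (toℕ i)
        g WTV.y = y
        g WTV.z = z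

        rank : WTV → ℕ
        rank (WTV.x _) = 0
        rank WTV.y = 1
        rank WTV.z = 2

        bd : ∀ (i : Fin 5) → toℕ i ≤ 4
        bd i = ≤-pred (Fin.toℕ<n i)

        g∈U : ∀ t → U (g t)
        g∈U (WTV.x i) = q∈U (bd i)
        g∈U WTV.y = y∈U
        g∈U WTV.z = z∈U

        y≢ : ∀ {i} → i ≤ 4 → y ≢ q i
        y≢ h = E⇒≢ (y~ h)

        z≢ : ∀ {i} → i ≤ 4 → z ≢ q i
        z≢ h refl = z≁y (E-sym (y~ h))

        distinct : ∀ t t′ → T (rank t ≤ᵇ rank t′) → g t ≡ g t′ → t ≡ t′
        distinct (WTV.x i) (WTV.x j) _ eq = cong WTV.x (Fin.toℕ-injective (inj-path Q (bd i) (bd j) eq))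
        distinct (WTV.x i) WTV.y _ eq = ⊥-elim (y≢ (bd i) (sym eq))
        distinct (WTV.x i) WTV.z _ eq = ⊥-elim (z≢ (bd i) (sym eq))
        distinct WTV.y WTV.y _ _ = refl
        distinct WTV.y WTV.z _ eq = ⊥-elim (z≁₀ (subst (λ t → E t (q 0)) eq (y~ z≤n)))
        distinct WTV.z WTV.z _ _ = refl

        match : ∀ t t′ → T (rank t ≤ᵇ rank t′) → adj G (g t) (g t′) ≡ wtE t t′ ∨ wtE t′ t
        match (WTV.x i) (WTV.x j) _ = adj-path Q (bd i) (bd j)
        match (WTV.x i) WTV.y _ = E-sym (y~ (bd i))
        match (WTV.x zero) WTV.z _ = non (¬E-sym z≁₀)
        match (WTV.x (suc zero)) WTV.z _ = non (¬E-sym z≁₁)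
        match (WTV.x (suc (suc zero))) WTV.z _ = E-sym z~₂
        match (WTV.x (suc (suc (suc zero)))) WTV.z _ = non (¬E-sym z≁₃)
        match (WTV.x (suc (suc (suc (suc zero))))) WTV.z _ = non (¬E-sym z≁₄)
        match WTV.y WTV.y _ = irrefl G _
        match WTV.y WTV.z _ = non (¬E-sym z≁y)
        match WTV.z WTV.z _ = irrefl G _

      whippingTop-copy : Copy U whippingTop
      whippingTop-copy = g , g∈U , wlog-inj rank g distinct , wlog-match rank g wtE match

-- Counting and maximising over a finite set.

module _ {n : ℕ} where

  count : {P : Fin n → Set} → Decidable P → ℕ
  count P? = ∣ tabulate (λ i → does (P? i)) ∣

  count-< : {P Q : Fin n → Set} (P? : Decidable P) (Q? : Decidable Q) →
    (∀ {x} → P x → Q x) → ∀ {y} → Q y → ¬ P y → count P? < count Q?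
  count-< P? Q? P⊆Q {y} Qy ¬Py = p⊂q⇒∣p∣<∣q∣ ((λ i∈ → to Q? (P⊆Q (from P? i∈))) , y , to Q? Qy , ¬Py ∘ from P?)
    where
    to : ∀ {R : Fin n → Set} (R? : Decidable R) {i} → R i → i ∈ tabulate (λ j → does (R? j))
    to R? {i} r = lookup⇒[]= i _ (trans (lookup∘tabulate _ i) (dec-true (R? i) r))
    from : ∀ {R : Fin n → Set} (R? : Decidable R) {i} → i ∈ tabulate (λ j → does (R? j)) → R i
    from R? {i} i∈ with R? i | trans (sym (lookup∘tabulate (λ j → does (R? j)) i)) ([]=⇒lookup i∈)
    ... | yes r | _ = r
    ... | no _ | ()

  count≤n : {P : Fin n → Set} (P? : Decidable P) → count P? ≤ n
  count≤n P? = ∣p∣≤n (tabulate (λ i → does (P? i)))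

  maximum : {C : Fin n → Set} → Decidable C → (f : Fin n → ℕ) → (∀ i → f i ≤ n) →
    ∀ {i} → C i → ∃ λ t → C t × (∀ {r} → C r → f r ≤ f t)
  maximum {C} C? f f≤n {i} Ci = go n i Ci (m≤n+m n (f i))
    where
    -- `s` bounds what is left to gain: each better element uses up one unit, and with none left
    -- `f t` has reached `n`.
    go : ∀ s t → C t → n ≤ f t + s → ∃ λ t → C t × (∀ {r} → C r → f r ≤ f t)
    go s t Ct h with Fin.any? (λ r → C? r ×-dec (f t <? f r))
    go s t Ct h | no none = t , Ct , λ {r} Cr → ≮⇒≥ (λ lt → none (r , Cr , lt))
    go zero t Ct h | yes (r , Cr , lt) = ⊥-elim (1+n≰n (≤-trans lt (≤-trans (f≤n r) (≤-trans h (≤-reflexive (+-identityʳ (f t)))))))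
    go (suc s) t Ct h | yes (r , Cr , lt) = go s r Cr (≤-trans h (≤-trans (≤-reflexive (+-suc (f t) s)) (+-monoˡ-≤ s lt)))

-- Deciding connectedness.

module Reachability {n : ℕ} (G : Graph (Fin n)) where

  open InGraph G

  walk? : {S : V → Set} → Decidable S → ∀ k a b → Dec (Walk S a b k)
  walk? S? zero a b with S? a | a Fin.≟ b
  ... | yes s | yes refl = yes (stop s)
  ... | no ¬s | _ = no λ { (stop s) → ¬s s }
  ... | yes _ | no a≢b = no λ { (stop _) → a≢b refl }
  walk? S? (suc k) a b with S? a | Fin.any? (λ c → E? a c ×-dec walk? S? k c b)
  ... | yes s | yes (c , e , w) = yes (step s e w)
  ... | no ¬s | _ = no λ { (step s _ _) → ¬s s }
  ... | yes _ | no none = no λ { (step _ e w) → none (_ , e , w) }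

  -- Lengths below `n` suffice: a shortest walk is an induced path, and with `n` or more steps it
  -- would repeat a vertex by the pigeonhole principle.
  conn? : {S : V → Set} → Decidable S → ∀ a b → Dec (Conn S a b)
  conn? {S} S? a b with anyUpTo? (λ k → walk? S? k a b) n
  ... | yes (k , _ , w) = yes (k , w)
  ... | no none = no λ conn → by-shortest conn λ { {k} (p , p0 , pk , p∈ , P) →
    none (k , ≰⇒> (λ n≤k → repeat p P (s≤s n≤k)) ,
      subst₂ (λ u v → Walk S u v k) p0 pk (segment p z≤n (λ l _ _ → p∈ l) (λ l _ l<k → link P l<k))) }
    where
    repeat : ∀ {k} p → IPath p k → ¬ n < suc k
    repeat p P n<k with Fin.pigeonhole n<k (λ i → p (toℕ i))
    ... | i , j , i<j , eq = dist P i<j (≤-pred (Fin.toℕ<n j)) eq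

-- Indices at which a property changes along a path.

module _ {Q : ℕ → Set} (Q? : ∀ i → Dec (Q i)) where

  descend : ¬ Q 0 → ∀ i → Q i → ∃ λ j → j < i × ¬ Q j × (∀ {l} → j < l → l ≤ i → Q l)
  descend ¬Q0 zero q = ⊥-elim (¬Q0 q)
  descend ¬Q0 (suc i) q with Q? i
  ... | no ¬q = i , ≤-refl , ¬q , λ i<l l≤si → subst Q (≤-antisym i<l l≤si) q
  ... | yes q′ with descend ¬Q0 i q′
  ... | j , j<i , ¬q , all = j , m≤n⇒m≤1+n j<i , ¬q , λ {l} j<l l≤si →
    [ (λ l<si → all j<l (≤-pred l<si)) , (λ { refl → q }) ]′ (m≤n⇒m<n∨m≡n l≤si)

  ascend-by : ∀ d i → Q i → ¬ Q (i + d) →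
    ∃ λ j → i ≤ j × j < i + d × ¬ Q (suc j) × (∀ {l} → i ≤ l → l ≤ j → Q l)
  ascend-by zero i q ¬q = ⊥-elim (¬q (subst Q (sym (+-identityʳ i)) q))
  ascend-by (suc d) i q ¬q with Q? (suc i)
  ... | no ¬q′ = i , ≤-refl , m<m+n i (s≤s z≤n) , ¬q′ , λ i≤l l≤i → subst Q (≤-antisym i≤l l≤i) q
  ... | yes q′ with ascend-by d (suc i) q′ (subst (¬_ ∘ Q) (+-suc i d) ¬q)
  ... | j , i<j , j< , ¬q″ , all = j , <⇒≤ i<j , subst (j <_) (sym (+-suc i d)) j< , ¬q″ , λ {l} i≤l l≤j →
    [ (λ i<l → all i<l l≤j) , (λ { refl → q }) ]′ (m≤n⇒m<n∨m≡n i≤l)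

  ascend : ∀ {i N} → i ≤ N → Q i → ¬ Q N →
    ∃ λ j → i ≤ j × j < N × ¬ Q (suc j) × (∀ {l} → i ≤ l → l ≤ j → Q l)
  ascend {i} {N} i≤N q ¬q =
    subst (λ t → ∃ λ j → i ≤ j × j < t × ¬ Q (suc j) × (∀ {l} → i ≤ l → l ≤ j → Q l)) (m+[n∸m]≡n i≤N)
      (ascend-by (N ∸ i) i q (subst (¬_ ∘ Q) (sym (m+[n∸m]≡n i≤N)) ¬q))

-- Vertex sets without the forbidden induced subgraphs.

module Local {n : ℕ} (G : Graph (Fin n)) (U : Fin n → Set)
  (no-cycle : ∀ m (h : 4 ≤ m) → ¬ InGraph.Copy G U (cycle m h))
  (no-longClaw : ¬ InGraph.Copy G U longClaw)
  (no-whippingTop : ¬ InGraph.Copy G U whippingTop)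
  (no-dagger : ∀ k → 2 ≤ k → ¬ InGraph.Copy G U (dagger k))
  (no-ddagger : ∀ k → 3 ≤ k → ¬ InGraph.Copy G U (ddagger k)) where

  open InGraph G

  E-stable : ∀ {x y} → ¬ ¬ E x y → E x y
  E-stable {x} {y} = decidable-stable (E? x y)

  Apart : V → V → V → Set
  Apart c d z = U z × z ≢ c × z ≢ d × ¬ (E c z × E z d)

  -- A shortest detour around an edge lying in no triangle with the detour would close an induced cycle.
  no-detour : ∀ {c d z₁ z₂ k} → U c → U d → E c d → E c z₁ → Walk (Apart c d) z₁ z₂ k → E z₂ d → ⊥
  no-detour {c} {d} {z₁} {z₂} {k} c∈ d∈ c~d c~z₁ w z₂~d = go k (<-wellFounded k) c~z₁ w z₂~d
    where
    go : ∀ k → Acc _<_ k → ∀ {z₁ z₂} → E c z₁ → Walk (Apart c d) z₁ z₂ k → E z₂ d → ⊥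
    -- A detour of a single vertex would form a triangle with `c` and `d`, which `Apart` excludes.
    go zero _ c~z (stop (_ , _ , _ , ¬both)) z~d = ¬both (c~z , z~d)
    go (suc k) (acc rec) c~z₁ w z₂~d with shortest w (λ l<k w′ → go _ (rec l<k) c~z₁ w′ z₂~d)
    ... | p , refl , refl , ap , P =
      no-cycle _ (s≤s (s≤s (s≤s (s≤s z≤n)))) (cycle-copy (cons-path P c~z₁ c≁ (λ _ → proj₁ (proj₂ (ap _)) ∘ sym))
        q∈U (s≤s (s≤s z≤n)) d∈ (E-sym c~d) (E-sym z₂~d) d≁ d≢)
      where
      q : ℕ → V
      q = cons c p
      part : ∀ {i j} → i ≤ j → j ≤ suc k → Walk (Apart c d) (p i) (p j) (j ∸ i)
      part i≤j j≤k = segment p i≤j (λ l _ _ → ap l) (λ l _ l<j → link P (≤-trans l<j j≤k))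
      -- A chord at `c` or at `d` cuts off part of the detour.
      c≁ : ∀ {i} → 0 < i → i ≤ suc k → ¬ E c (p i)
      c≁ {suc i} _ i≤k e = go _ (rec (s≤s (m∸n≤m k i))) e (part i≤k ≤-refl) z₂~d
      q∈U : ∀ {i} → i ≤ 2 + k → U (q i)
      q∈U {zero} _ = c∈
      q∈U {suc i} _ = proj₁ (ap i)
      d≁ : ∀ {i} → 0 < i → i < 2 + k → ¬ E d (q i)
      d≁ {suc i} _ (s≤s i<k) e = go _ (rec i<k) c~z₁ (part z≤n (<⇒≤ i<k)) (E-sym e)
      d≢ : ∀ {i} → i ≤ 2 + k → d ≢ q i
      d≢ {zero} _ = E⇒≢ (E-sym c~d)
      d≢ {suc i} _ eq = proj₁ (proj₂ (proj₂ (ap i))) (sym eq)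

  -- Otherwise the path `d`, `c` would be a detour around the edge from `a` to `b`, and the four
  -- vertices an induced cycle.
  square : ∀ {a b c d} → U a → U b → U c → U d → E a b → E b c → E c d → E d a →
    a ≢ c → b ≢ d → ¬ E a c → E b d
  square a∈ b∈ c∈ d∈ ab bc cd da a≢c b≢d ¬ac = E-stable λ ¬bd →
    no-detour a∈ b∈ ab (E-sym da)
      (step (d∈ , E⇒≢ da , b≢d ∘ sym , λ (_ , db) → ¬bd (E-sym db)) (E-sym cd)
        (stop (c∈ , a≢c ∘ sym , E⇒≢ bc ∘ sym , λ (ac , _) → ¬ac ac)))
      (E-sym bc)

  module OnPath {p : ℕ → V} {N : ℕ} (P : IPath p N) (p∈U : ∀ {i} → i ≤ N → U (p i)) where

    -- If `v` missed `p (suc i)`, the path from there to `p j` followed by `w` would be a detour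
    -- around the edge from `p i` to `v`: on the path only `p (suc i)` sees `p i`. The walk `w` may
    -- itself use the assumption being refuted.
    bridge : ∀ {v z k i j} → U v → i < j → j ≤ N → E v (p i) → (∀ {l} → i < l → l ≤ j → v ≢ p l) →
      (¬ E v (p (suc i)) → Walk (Apart (p i) v) (p j) z k) → E z v → E v (p (suc i))
    bridge {v} {i = i} {j} v∈ i<j j≤N v~ v≢ w z~v = E-stable λ ¬e →
      no-detour (p∈U (≤-trans (<⇒≤ i<j) j≤N)) v∈ (E-sym v~) (link P (≤-trans i<j j≤N))
        (segment p i<j (λ l i<l l≤j → apart ¬e i<l l≤j) (λ l _ l<j → link P (≤-trans l<j j≤N)) ++ w ¬e) z~v
      where
      apart : ¬ E v (p (suc i)) → ∀ {l} → i < l → l ≤ j → Apart (p i) v (p l)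
      apart ¬e {l} i<l l≤j = p∈U (≤-trans l≤j j≤N) , dist P i<l (≤-trans l≤j j≤N) ∘ sym , v≢ i<l l≤j ∘ sym ,
        λ (e , f) → ¬e (E-sym (subst (λ t → E (p t) v) (next P i<l (≤-trans l≤j j≤N) e) f))

    follow : ∀ {v i j} → U v → i < j → j ≤ N → E v (p i) → E v (p j) →
      (∀ {l} → i < l → l ≤ j → v ≢ p l) → E v (p (suc i))
    follow {v} {i} {j} v∈ i<j j≤N v~i v~j v≢ = bridge v∈ i<j j≤N v~i v≢
      (λ ¬e → stop (p∈U j≤N , dist P i<j j≤N ∘ sym , v≢ i<j ≤-refl ∘ sym ,
        λ (e , _) → ¬e (subst (λ t → E v (p t)) (next P i<j j≤N e) v~j)))
      (E-sym v~j)

    -- The maximal run of neighbours of `c` around `i` is bounded by a non-neighbour on each side.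
    -- With these two vertices and `s` pendant at `c` it forms a dagger.
    run : ∀ {c s i} → U c → U s → E c s → (∀ {l} → l ≤ N → ¬ E s (p l)) →
      ¬ E c (p 0) → ¬ E c (p N) → i < N → E c (p i) → E c (p (suc i)) → ⊥
    run {c} {s} {i} c∈ s∈ c~s s≁ ¬first ¬last i<N e e′
      with descend (λ l → E? c (p l)) ¬first i e | ascend (λ l → E? c (p l)) i<N e′ ¬last
    ... | j , j<i , ¬ej , below | j′ , i<j′ , j′<N , ¬ej′ , above =
      no-dagger k 2≤k (dagger-copy (sub-path P j (inside ≤-refl))
        (λ l≤ → p∈U (inside l≤)) 2≤k c∈ s∈ c~s (λ l≤ → s≁ (inside l≤))
        ¬ej (subst (λ t → ¬ E c (p (suc t))) (sym jk) ¬ej′)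
        (λ 1≤l l≤k → between (+-monoˡ-≤ j 1≤l) (≤-trans (+-monoˡ-≤ j l≤k) (≤-reflexive jk))))
      where
      -- The run is `suc j`, ..., `j′`; it contains both `i` and `suc i`, hence `2 ≤ k`.
      k = j′ ∸ j
      j≤j′ : j ≤ j′
      j≤j′ = ≤-trans (<⇒≤ j<i) (<⇒≤ i<j′)
      jk : k + j ≡ j′
      jk = m∸n+n≡m j≤j′
      inside : ∀ {l} → l ≤ suc k → l + j ≤ N
      inside l≤ = ≤-trans (+-monoˡ-≤ j l≤) (≤-trans (≤-reflexive (cong suc jk)) j′<N)
      2≤k : 2 ≤ k
      2≤k = ≤-trans (≤-reflexive (sym (m+n∸n≡m 2 j))) (∸-monoˡ-≤ j (≤-trans (s≤s j<i) i<j′))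
      between : ∀ {l} → j < l → l ≤ j′ → E c (p l)
      between {l} j<l l≤j′ with l ≤? i
      ... | yes l≤i = below j<l l≤i
      ... | no l≰i = above (≰⇒> l≰i) l≤j′

    -- Let `i` end the initial run of neighbours of `u`, and let `j` be the last non-neighbour of
    -- `v` before `i`. Between `p j` and `p (suc i)`, `u` misses only the last vertex and `v` only
    -- the first, so a double dagger appears with `w` on top.
    sun : ∀ {u v w} → U u → U v → U w → E u v → E w u → E w v → (∀ {l} → l ≤ N → ¬ E w (p l)) →
      E u (p 0) → ¬ E u (p N) → ¬ E v (p 0) → E v (p N) → ⊥
    sun {u} {v} {w} u∈ v∈ w∈ u~v w~u w~v w≁ u~0 u≁N v≁0 v~N
      with ascend (λ l → E? u (p l)) z≤n u~0 u≁N
    ... | i , _ , i<N , ¬ui , u-below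
      with descend (λ l → E? v (p l)) v≁0 i v~i
      where
      -- If `v` missed `p i`, the path onward to `p N` followed by `v` would be a way back to `u`,
      -- and `bridge` would make `u` see `p (suc i)`.
      v~i : E v (p i)
      v~i = E-stable λ v≁i → ¬ui (bridge u∈ i<N ≤-refl (u-below z≤n ≤-refl)
        (λ _ l≤N → λ { refl → w≁ l≤N w~u })
        (λ ¬e → step (p∈U ≤-refl , dist P i<N ≤-refl ∘ sym , (λ { refl → w≁ ≤-refl w~u }) ,
            λ (e , f) → ¬e (E-sym (subst (λ t → E (p t) u) (next P i<N ≤-refl e) f)))
          (E-sym v~N)
          (stop (v∈ , (λ { refl → w≁ (<⇒≤ i<N) w~v }) , E⇒≢ u~v ∘ sym , λ (e , _) → v≁i (E-sym e))))
        (E-sym u~v))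
    ... | j , j<i , ¬vj , v-below =
      no-ddagger (suc M) (s≤s 2≤M) (ddagger-copy (sub-path P j (inside ≤-refl))
        (λ l≤ → p∈U (inside l≤)) (<⇒≤ 2≤M) u∈ v∈ w∈ u~v w~u w~v (λ l≤ → w≁ (inside l≤))
        (λ l<M → u-below z≤n (≤-pred (≤-trans (+-monoˡ-≤ j l<M) (≤-reflexive len))))
        (subst (λ t → ¬ E u (p t)) (sym len) ¬ui)
        ¬vj (λ 0<l l≤M → v-all (+-monoˡ-≤ j 0<l) (≤-trans (+-monoˡ-≤ j l≤M) (≤-reflexive len))))
      where
      M = suc i ∸ j
      len : M + j ≡ suc i
      len = m∸n+n≡m (m≤n⇒m≤1+n (<⇒≤ j<i))
      inside : ∀ {l} → l ≤ M → l + j ≤ N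
      inside l≤ = ≤-trans (+-monoˡ-≤ j l≤) (≤-trans (≤-reflexive len) i<N)
      2≤M : 2 ≤ M
      2≤M = ≤-trans (≤-reflexive (sym (m+n∸n≡m 2 j))) (∸-monoˡ-≤ j (s≤s j<i))
      v~si : E v (p (suc i))
      v~si with m≤n⇒m<n∨m≡n i<N
      ... | inj₂ refl = v~N
      ... | inj₁ si<N = follow v∈ i<N ≤-refl (v-below j<i ≤-refl) v~N (λ _ l≤N → λ { refl → w≁ l≤N w~v })
      v-all : ∀ {l} → j < l → l ≤ suc i → E v (p l)
      v-all {l} j<l l≤si with m≤n⇒m<n∨m≡n l≤si
      ... | inj₁ l<si = v-below j<l (≤-pred l<si)
      ... | inj₂ refl = v~si

  -- Asteroidal triples

  Away : V → V → Set
  Away c z = U z × z ≢ c × ¬ E c z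

  -- An asteroidal triple for which the total length of the two paths from x is least, x being fixed.
  record Triple (x a b : V) (m m′ : ℕ) : Set where
    field
      y z : ℕ → V
      Y : IPath y m
      Z : IPath z m′
      y-start : y 0 ≡ x
      z-start : z 0 ≡ x
      y-end : y m ≡ a
      z-end : z m′ ≡ b
      y∈ : ∀ i → Away b (y i)
      z∈ : ∀ i → Away a (z i)
      a-b : Conn (Away x) a b
      smaller : ∀ {a′ b′ l l′} → l + l′ < m + m′ →
        Walk (Away b′) x a′ l → Walk (Away a′) x b′ l′ → Conn (Away x) a′ b′ → ⊥

  mirror : ∀ {x a b m m′} → Triple x a b m m′ → Triple x b a m′ m
  mirror {m = m} {m′} t = record
    { y = z ; z = y ; Y = Z ; Z = Y ; y-start = z-start ; z-start = y-start ; y-end = z-end ; z-end = y-end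
    ; y∈ = z∈ ; z∈ = y∈ ; a-b = _ , reverse E-sym (proj₂ a-b)
    ; smaller = λ {_} {_} {l} {l′} h → smaller (subst (l + l′ <_) (+-comm m′ m) h) }
    where open Triple t

  module Facts {x a b m m′} (t : Triple x a b m m′) where
    open Triple t public

    a-away-x : Away x a
    a-away-x = start∈ (proj₂ a-b)

    b-away-x : Away x b
    b-away-x = end∈ (proj₂ a-b)

    x∈ : U x
    x∈ = subst U y-start (proj₁ (y∈ 0))

    a≁b : ¬ E a b
    a≁b e = proj₂ (proj₂ (y∈ m)) (subst (E b) (sym y-end) (E-sym e))

    y∈U : ∀ {i} → i ≤ m → U (y i)
    y∈U {i} _ = proj₁ (y∈ i)

    b≁y : ∀ {i} → ¬ E b (y i)
    b≁y {i} = proj₂ (proj₂ (y∈ i))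

    x~y : 1 ≤ m → E x (y 1)
    x~y h = subst (λ v → E v (y 1)) y-start (link Y h)

    y-away-x : ∀ {i} → 2 ≤ i → i ≤ m → Away x (y i)
    y-away-x {i} 2≤i i≤m = y∈U i≤m , (λ eq → dist Y (<⇒≤ 2≤i) i≤m (trans y-start (sym eq))) ,
      subst (λ v → ¬ E v (y i)) y-start (far Y 2≤i i≤m)

    a~y : ∀ {i} → suc i ≡ m → E a (y i)
    a~y {i} refl = subst (λ v → E v (y i)) y-end (E-sym (link Y ≤-refl))

    a≁y : ∀ {i} → suc i < m → ¬ E a (y i)
    a≁y {i} h = subst (λ v → ¬ E v (y i)) y-end (far′ Y h ≤-refl)

    x-z : Walk (Away a) x b m′
    x-z = subst₂ (λ u v → Walk (Away a) u v m′) z-start z-end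
      (segment z z≤n (λ l _ _ → z∈ l) (λ l _ l< → link Z l<))

    -- The shorter walk in place of `y` would give a triple with a smaller sum of lengths.
    shorter : ∀ {l} → l < m → ¬ Walk (Away b) x a l
    shorter l<m w = smaller (+-monoˡ-< m′ l<m) w x-z a-b

    2≤m : 2 ≤ m
    2≤m = go m refl
      where
      go : ∀ k → k ≡ m → 2 ≤ m
      go zero refl = ⊥-elim (proj₁ (proj₂ a-away-x) (trans (sym y-end) y-start))
      go (suc zero) refl = ⊥-elim (proj₂ (proj₂ a-away-x) (subst (E x) y-end (x~y ≤-refl)))
      go (suc (suc _)) refl = s≤s (s≤s z≤n)

    -- Otherwise `y i` could replace `a`: the rest of `y`, continued by the path from `a` to `b`,
    -- joins it to `b` away from `x`.
    hit : 1 ≤ m′ → ∀ {i} → 2 ≤ i → i < m → ∃ λ j → j < suc m′ × E (y i) (z j)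
    hit 1≤m′ {i} 2≤i i<m with anyUpTo? (λ j → E? (y i) (z j)) (suc m′)
    ... | yes found = found
    ... | no none = ⊥-elim (smaller {a′ = y i} {b} (+-monoˡ-< m′ i<m)
      (subst (λ v → Walk (Away b) v (y i) i) y-start
        (segment y z≤n (λ l _ _ → y∈ l) (λ l _ l<i → link Y (<-trans l<i i<m))))
      (subst₂ (λ u v → Walk (Away (y i)) u v m′) z-start z-end
        (segment z z≤n (λ l _ l≤m′ → proj₁ (z∈ l) , (λ eq → off-path Z 1≤m′ ¬hit l≤m′ (sym eq)) , ¬hit l≤m′)
          (λ l _ l< → link Z l<)))
      (_ , segment y (<⇒≤ i<m) (λ l i≤l l≤m → y-away-x (≤-trans 2≤i i≤l) l≤m) (λ l _ l<m → link Y l<m)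
        ++ subst (λ v → Walk (Away x) v b _) (sym y-end) (proj₂ a-b)))
      where
      ¬hit : ∀ {j} → j ≤ m′ → ¬ E (y i) (z j)
      ¬hit {j} j≤m′ e = none (j , s≤s j≤m′ , e)

  apart-from : ∀ {x d w} → E x d → Away x w → Apart x d w
  apart-from x~d (w∈ , w≢x , x≁w) = w∈ , w≢x , (λ { refl → x≁w x~d }) , (λ (e , _) → x≁w e)

  -- `sun` applies to a shortest path from `a` to `b` away from `x`, with `y 1` and `z 1` as the two
  -- hubs and `x` attached to both.
  short-short : ∀ {x a b} → ¬ Triple x a b 2 2
  short-short {x} {a} {b} t = by-shortest a-b λ { {k} (p , refl , refl , p∈ , P) →
    OnPath.sun P (λ _ → proj₁ (p∈ _)) (y∈U (s≤s z≤n)) (M.y∈U (s≤s z≤n)) x∈ y~z (x~y (s≤s z≤n)) (M.x~y (s≤s z≤n))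
      (λ _ → proj₂ (proj₂ (p∈ _)))
      (E-sym (a~y refl)) (¬E-sym b≁y) (¬E-sym M.b≁y) (E-sym (M.a~y refl)) }
    where
    open Facts t
    module M = Facts (mirror t)
    -- Otherwise `z 1`, `b` and the path on to `a` form a detour around the edge from `x` to `y 1`.
    y~z : E (y 1) (z 1)
    y~z = E-stable λ ¬e → no-detour x∈ (y∈U (s≤s z≤n)) (x~y (s≤s z≤n)) (M.x~y (s≤s z≤n))
      (step (M.y∈U (s≤s z≤n) , E⇒≢ (E-sym (M.x~y (s≤s z≤n))) , (λ eq → M.b≁y (subst (E a) (sym eq) (a~y refl))) , λ (_ , e) → ¬e (E-sym e))
        (E-sym (M.a~y refl))
        (map-walk (apart-from (x~y (s≤s z≤n))) (reverse E-sym (proj₂ a-b))))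
      (a~y refl)

  -- Triples with both paths from `x` longer than two.

  module Fork {x a b μ ν} (t : Triple x a b (3 + μ) (3 + ν)) where
    open Facts t
    module M = Facts (mirror t)

    c d : V
    c = y (2 + μ)
    d = z (2 + ν)

    c∈ : U c
    c∈ = proj₁ (y∈ _)

    d∈ : U d
    d∈ = proj₁ (z∈ _)

    b∈ : U b
    b∈ = proj₁ b-away-x

    a∈ : U a
    a∈ = proj₁ a-away-x

    c-away : Away x c
    c-away = y-away-x (s≤s (s≤s z≤n)) (n≤1+n _)

    d-away : Away x d
    d-away = M.y-away-x (s≤s (s≤s z≤n)) (n≤1+n _)

    a~c : E a c
    a~c = a~y refl

    b~d : E b d
    b~d = M.a~y refl

    d≁start : ¬ E d (y 0)
    d≁start e = proj₂ (proj₂ d-away) (E-sym (subst (E d) y-start e))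

    d≁end : ¬ E d (y (3 + μ))
    d≁end e = M.b≁y (E-sym (subst (E d) y-end e))

    -- `d` misses both ends of `y`, and its neighbour `b` misses all of `y`, so two consecutive
    -- neighbours of `d` would give a dagger.
    run-at : ∀ {i} → i < 3 + μ → E d (y i) → E d (y (suc i)) → ⊥
    run-at = OnPath.run Y y∈U d∈ b∈ (E-sym b~d) (λ _ → b≁y) d≁start d≁end

    -- Unless `d` has two consecutive neighbours on `y`, the way from `c` back along `y` to `x` and
    -- out along `z` to `d` is a detour around the edge from `c` to `d`.
    adjacent : E c d → ¬ E c (z (1 + ν)) → ⊥
    adjacent c~d ¬cz with E? d (y (1 + μ))
    ... | yes e = run-at (n≤1+n _) e (E-sym c~d)
    ... | no ¬dy = no-detour c∈ d∈ c~d (E-sym (link Y (n≤1+n _)))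
      (reverse E-sym (segment y {0} {1 + μ} z≤n (λ i _ → y-apart) (λ i _ i< → link Y (≤-trans i< (≤-trans (n≤1+n _) (n≤1+n _)))))
        ++ subst (λ v → Walk (Apart c d) v (z (1 + ν)) (1 + ν)) (trans z-start (sym y-start))
          (segment z {0} {1 + ν} z≤n (λ j _ → z-apart) (λ j _ j< → link Z (≤-trans j< (≤-trans (n≤1+n _) (n≤1+n _))))))
      (link Z (n≤1+n _))
      where
      y-apart : ∀ {i} → i ≤ 1 + μ → Apart c d (y i)
      y-apart {i} i≤ = proj₁ (y∈ i) , dist Y (s≤s i≤) (n≤1+n _) ,
        (λ eq → b≁y (subst (E b) (sym eq) b~d)) ,
        λ (e , f) → ¬dy (E-sym (subst (λ l → E (y l) d) (suc-injective (sym (next Y (s≤s i≤) (n≤1+n _) (E-sym e)))) f))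
      z-apart : ∀ {j} → j ≤ 1 + ν → Apart c d (z j)
      z-apart {j} j≤ = proj₁ (z∈ j) , (λ eq → M.b≁y (subst (E a) (sym eq) a~c)) ,
        dist Z (s≤s j≤) (n≤1+n _) ,
        λ (e , f) → ¬cz (subst (λ l → E c (z l)) (suc-injective (sym (next Z (s≤s j≤) (n≤1+n _) f))) e)

  -- Both c and d hang off the neighbour α of x. A path from c to d away from x lies in the neighbourhood of α.
  module Claw {x a b ν} (t : Triple x a b 3 (3 + ν)) where
    open Fork t
    open Facts t

    module _ (¬cd : ¬ E c d) (α~d : E (y 1) d) where

      α : V
      α = y 1

      α∈ : U α
      α∈ = proj₁ (y∈ 1)

      x~α : E x α
      x~α = x~y (s≤s z≤n)

      α≁a : ¬ E α a
      α≁a = ¬E-sym (a≁y (s≤s (s≤s (s≤s z≤n))))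

      Fan : V → Set
      Fan w = Away x w × (w ≡ a ⊎ w ≡ b ⊎ E α w)

      -- `α` sees both ends of an induced path from `c` to `d`, so `follow` makes it see the whole
      -- path. Adding `a` and `b` at the ends gives a walk inside `Fan`, which is then shortened.
      fan-walk : Conn (Away x) c d → (∀ {k} → Induced Fan a b k → ⊥) → ⊥
      fan-walk cd f = by-shortest cd λ { {k} (p , p0 , pk , p∈ , P) →
        let
          α≢ : ∀ {l} → α ≢ p l
          α≢ {l} eq = proj₂ (proj₂ (p∈ l)) (subst (E x) eq x~α)
          α~ : ∀ {l} → l ≤ k → E α (p l)
          α~ = all P (λ _ → proj₁ (p∈ _)) p0 pk α≢
        in by-shortest {S = Fan}
          (_ , step (a-away-x , inj₁ refl) (subst (E a) (sym p0) a~c)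
            (segment p z≤n (λ l _ l≤k → p∈ l , inj₂ (inj₂ (α~ l≤k))) (λ l _ l<k → link P l<k)
             ++ step (p∈ k , inj₂ (inj₂ (α~ ≤-refl))) (subst (λ v → E v b) (sym pk) (E-sym b~d))
               (stop (b-away-x , inj₂ (inj₁ refl))))) f }
        where
        all : ∀ {p k} (P : IPath p k) → (∀ {l} → l ≤ k → U (p l)) → p 0 ≡ c → p k ≡ d → (∀ {l} → α ≢ p l) →
          ∀ {l} → l ≤ k → E α (p l)
        all P p∈U p0 pk α≢ {zero} _ = subst (E α) (sym p0) (link Y (s≤s (s≤s z≤n)))
        all {p} P p∈U p0 pk α≢ {suc l} l<k = OnPath.follow P p∈U α∈ l<k ≤-refl
          (all P p∈U p0 pk α≢ (<⇒≤ l<k)) (subst (E α) (sym pk) α~d) (λ _ _ → α≢)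

      claw : ⊥
      claw = fan-walk (_ , step c-away (E-sym a~c) (snoc (proj₂ a-b) b~d d-away)) short
        where
        short : ∀ {k} → Induced Fan a b k → ⊥
        short {zero} (q , q0 , qk , _) = b≁y (subst (λ v → E v c) (trans (sym q0) qk) a~c)
        short {suc zero} (q , q0 , qk , _ , Q) = a≁b (subst₂ E q0 qk (link Q ≤-refl))
        short {suc (suc zero)} (q , refl , refl , q∈ , Q) with q∈ 1
        ... | _ , inj₁ eq = dist Q ≤-refl (s≤s z≤n) (sym eq)
        ... | _ , inj₂ (inj₁ eq) = dist Q ≤-refl ≤-refl eq
        -- With a single vertex `π` between `a` and `b`, two squares make `π` see all of `a`, `c`,
        -- `α`, `d`, `b`; `x` hangs at the middle vertex `α` of this path.
        ... | π-away@(π∈ , _ , x≁π) , inj₂ (inj₂ α~π) = no-whippingTop (whippingTop-copy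
          (five-path a~c (E-sym (link Y (s≤s (s≤s z≤n)))) α~d (E-sym b~d)
            (¬E-sym α≁a) M.b≁y a≁b ¬cd (¬E-sym b≁y) (¬E-sym b≁y))
          five∈ π∈ x∈ π~ x≁π x~α (proj₂ (proj₂ a-away-x)) (proj₂ (proj₂ c-away)) (proj₂ (proj₂ d-away)) (proj₂ (proj₂ b-away-x)))
          where
          π : V
          π = q 1
          a~π : E a π
          a~π = link Q (s≤s z≤n)
          π~b : E π b
          π~b = link Q ≤-refl
          c~π : E c π
          c~π = square a∈ c∈ α∈ π∈ a~c (E-sym (link Y (s≤s (s≤s z≤n)))) α~π (E-sym a~π)
            (λ eq → dist Y (s≤s (s≤s z≤n)) ≤-refl (trans (sym eq) (sym y-end)))
            (λ eq → b≁y (subst (E b) (sym eq) (E-sym π~b))) (¬E-sym α≁a)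
          d~π : E d π
          d~π = square b∈ d∈ α∈ π∈ b~d (E-sym α~d) α~π π~b
            (λ eq → proj₁ (proj₂ (y∈ 1)) (sym eq)) (λ eq → M.b≁y (subst (E a) (sym eq) a~π)) b≁y
          five∈ : ∀ {i} → i ≤ 4 → U (five a c α d b i)
          five∈ {0} _ = a∈
          five∈ {1} _ = c∈
          five∈ {2} _ = α∈
          five∈ {3} _ = d∈
          five∈ {suc (suc (suc (suc _)))} _ = b∈
          π~ : ∀ {i} → i ≤ 4 → E π (five a c α d b i)
          π~ {0} _ = E-sym a~π
          π~ {1} _ = E-sym c~π
          π~ {2} _ = E-sym α~π
          π~ {3} _ = E-sym d~π
          π~ {suc (suc (suc (suc _)))} _ = π~b
        -- Here there are at least two inner vertices, all of them neighbours of `α`, while `α`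
        -- misses `a` and `b`; `x` serves as the pendant vertex of a dagger.
        short {suc (suc (suc k))} (q , refl , refl , q∈ , Q) =
          OnPath.run Q (λ _ → proj₁ (proj₁ (q∈ _))) α∈ x∈ (E-sym x~α) (λ _ → proj₂ (proj₂ (proj₁ (q∈ _))))
            α≁a (¬E-sym b≁y) (s≤s (s≤s z≤n)) (inner ≤-refl (s≤s (s≤s z≤n))) (inner (s≤s z≤n) (s≤s (s≤s (s≤s z≤n))))
          where
          inner : ∀ {i} → 1 ≤ i → i < 3 + k → E α (q i)
          inner {i} 1≤i i<k with q∈ i
          ... | _ , inj₁ eq = ⊥-elim (dist Q 1≤i (<⇒≤ i<k) (sym eq))
          ... | _ , inj₂ (inj₁ eq) = ⊥-elim (dist Q i<k ≤-refl eq)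
          ... | _ , inj₂ (inj₂ e) = e

  -- For `μ = 0` this is `Claw`. Otherwise, unless `d` sees two consecutive vertices of `y`, the
  -- vertex `y (1 + μ)` is the centre of a long claw: two legs run along `y`, the third through `d`
  -- to `b`.
  fork : ∀ {x a b} μ {ν} (t : Triple x a b (3 + μ) (3 + ν)) →
    ¬ E (Fork.c t) (Fork.d t) → E (Fork.d t) (Triple.y t (1 + μ)) → ⊥
  fork zero t ¬cd d~ = Claw.claw t ¬cd (E-sym d~)
  fork {x} {a} {b} (suc κ) t ¬cd d~ with E? (Fork.d t) (Triple.y t (1 + κ))
  ... | yes e = Fork.run-at t (≤-trans (n≤1+n _) (n≤1+n _)) e d~
  ... | no ¬e = no-longClaw (longClaw-copy (sub-path Y κ ≤-refl) (λ _ → proj₁ (y∈ _)) d∈ b∈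
      d~ (λ e → ¬e (E-sym (square (proj₁ (y∈ _)) (proj₁ (y∈ _)) (proj₁ (y∈ _)) d∈
             (link Y (s≤s (m≤n+m κ 3))) (link Y (s≤s (s≤s (m≤n+m κ 2)))) (E-sym d~) e
             (dist Y (n≤1+n _) (≤-trans (n≤1+n _) (n≤1+n _)))
             (λ eq → b≁y (subst (E b) (sym eq) b~d))
             (far Y ≤-refl (≤-trans (n≤1+n _) (n≤1+n _))))))
      ¬e (¬E-sym ¬cd) d≁end (E-sym b~d) (λ _ → b≁y))
    where
    open Fork t
    open Facts t

  long-long : ∀ {x a b μ ν} → ¬ Triple x a b (3 + μ) (3 + ν)
  long-long {x} {a} {b} {μ} {ν} t with E? (Fork.c t) (Fork.d t)
  ... | yes c~d with E? (Fork.c t) (Triple.z t (1 + ν))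
  ...   | yes e = Fork.run-at (mirror t) (n≤1+n _) e c~d
  ...   | no ¬e = Fork.adjacent t c~d ¬e
  long-long {x} {a} {b} {μ} {ν} t | no ¬cd with E? (Fork.d t) (Triple.y t (1 + μ)) | E? (Fork.c t) (Triple.z t (1 + ν))
  ... | yes e | _ = fork μ t ¬cd e
  ... | _ | yes e = fork ν (mirror t) (¬E-sym ¬cd) e
  -- `gap` in both directions gives `1 + μ ≤ ν` and `1 + ν ≤ μ`.
  ... | no ¬dy | no ¬cz = 1+n≰n (≤-trans (gap t ¬cd ¬cz) (<⇒≤ (gap (mirror t) (¬E-sym ¬cd) ¬dy)))
    where
    -- By `hit`, `c` sees some `z j`, and the excluded positions leave `j ≤ ν`. Going along `z` to
    -- `z j`, then to `c` and `a`, takes `j + 2` steps, which by `shorter` is at least `3 + μ`.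
    gap : ∀ {x a b μ ν} (t : Triple x a b (3 + μ) (3 + ν)) → ¬ E (Fork.c t) (Fork.d t) →
      ¬ E (Fork.c t) (Triple.z t (1 + ν)) → 1 + μ ≤ ν
    gap {x} {a} {b} {μ} {ν} t ¬cd ¬cz with Facts.hit t (s≤s z≤n) {2 + μ} (s≤s (s≤s z≤n)) ≤-refl
    ... | j , j<4+ν , e = go (<-cmp j (1 + ν))
      where
      open Fork t
      open Facts t
      go : _ → 1 + μ ≤ ν
      go (tri≈ _ refl _) = ⊥-elim (¬cz e)
      go (tri> _ _ j>) with m≤n⇒m<n∨m≡n j>
      ... | inj₂ refl = ⊥-elim (¬cd e)
      ... | inj₁ j>′ with ≤-antisym j>′ (≤-pred j<4+ν)
      ...   | refl = ⊥-elim (b≁y (E-sym (subst (E c) z-end e)))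
      go (tri< j< _ _) with 1 + μ ≤? ν
      ... | yes h = h
      ... | no ¬h = ⊥-elim (shorter (≤-trans (s≤s (+-monoˡ-≤ 2 (≤-trans (≤-pred j<) (≤-pred (≰⇒> ¬h))))) (≤-reflexive (cong suc (+-comm μ 2))))
        (subst (λ v → Walk (Away b) v (z j) j) z-start
          (segment z z≤n (λ l _ l≤j → z-away (≤-trans (s≤s l≤j) j<)) (λ l _ l<j → link Z (≤-trans l<j (≤-trans (<⇒≤ j<) (≤-trans (n≤1+n _) (n≤1+n _))))))
          ++ step (z-away j<) (E-sym e) (step (y∈ _) (E-sym a~c) (stop (subst (Away b) y-end (y∈ _))))))
        where
        z-away : ∀ {l} → l < 1 + ν → Away b (z l)
        z-away {l} h = proj₁ (z∈ l) , (λ eq → dist Z (≤-trans h (≤-trans (n≤1+n _) (n≤1+n _))) ≤-refl (trans eq (sym z-end))) , M.a≁y (s≤s (≤-trans h (n≤1+n _)))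

  -- Triples with one path of length two and one longer.

  module Broom {x a b ν} (t : Triple x a b 2 (3 + ν)) where
    open Facts t
    module M = Facts (mirror t)

    α β : V
    α = y 1
    β = z 1

    α∈ : U α
    α∈ = proj₁ (y∈ 1)

    x~α : E x α
    x~α = x~y (s≤s z≤n)

    x~β : E x β
    x~β = M.x~y (s≤s z≤n)

    a~α : E a α
    a~α = a~y refl

    z∈U : ∀ {j} → U (z j)
    z∈U = proj₁ (z∈ _)

    z≢α : ∀ {j} → 1 ≤ j → j ≤ 3 + ν → z j ≢ α
    z≢α _ _ eq = M.b≁y (subst (E a) (sym eq) a~α)

    α≁end : ¬ E α (z (3 + ν))
    α≁end e = b≁y (E-sym (subst (E α) z-end e))

    -- Otherwise a and z j would form a smaller triple with x.
    α~far : ∀ {j} → 2 ≤ j → j < 3 + ν → E α (z j)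
    α~far {j} 2≤j j< = E-stable λ ¬e → smaller {b′ = z j} (s≤s (s≤s j<))
      (subst₂ (λ u v → Walk (Away (z j)) u v 2) y-start y-end (segment y {0} {2} z≤n (λ l _ l≤2 → y-away ¬e l≤2) (λ l _ l< → link Y l<)))
      (subst (λ v → Walk (Away a) v (z j) j) z-start (segment z z≤n (λ l _ _ → z∈ l) (λ l _ l<j → link Z (<-trans l<j j<))))
      (_ , proj₂ a-b ++ reverse E-sym (subst (λ v → Walk (Away x) (z j) v (3 + ν ∸ j)) z-end
        (segment z (<⇒≤ j<) (λ l j≤l l≤ → M.y-away-x (≤-trans 2≤j j≤l) l≤) (λ l _ l< → link Z l<))))
      where
      x-away : Away x (z j)
      x-away = M.y-away-x 2≤j (<⇒≤ j<)
      y-away : ¬ E α (z j) → ∀ {l} → l ≤ 2 → Away (z j) (y l)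
      y-away ¬e {0} _ = subst (Away (z j)) (sym y-start) (x∈ , (λ eq → proj₁ (proj₂ x-away) (sym eq)) , ¬E-sym (proj₂ (proj₂ x-away)))
      y-away ¬e {1} _ = α∈ , (λ eq → proj₂ (proj₂ x-away) (subst (E x) eq x~α)) , ¬E-sym ¬e
      y-away ¬e {2} _ = subst (Away (z j)) (sym y-end) (proj₁ a-away-x , (λ eq → proj₁ (proj₂ (z∈ j)) (sym eq)) , ¬E-sym M.b≁y)
      y-away ¬e {suc (suc (suc l))} (s≤s (s≤s ()))

    -- For `j = 1`, the vertices `x`, `α`, `z 2`, `z 1` form a square in which `x` misses `z 2`.
    α~z : ∀ {j} → j < 3 + ν → E α (z j)
    α~z {zero} _ = subst (E α) (sym z-start) (E-sym x~α)
    α~z {suc zero} _ = square x∈ α∈ z∈U z∈U x~α (α~far ≤-refl (s≤s (s≤s (s≤s z≤n))))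
      (E-sym (link Z (s≤s (s≤s z≤n)))) (E-sym x~β)
      (λ eq → proj₁ (proj₂ x-away) (sym eq)) (λ eq → z≢α ≤-refl (s≤s z≤n) (sym eq)) (proj₂ (proj₂ x-away))
      where
      x-away : Away x (z 2)
      x-away = M.y-away-x ≤-refl (s≤s (s≤s z≤n))
    α~z {suc (suc j)} = α~far (s≤s (s≤s z≤n))

    -- Only `z 1`, ..., `z (3 + ν)` are considered; `z 0` is `x` itself, from which the vertices in
    -- question are away.
    Misses : V → Set
    Misses w = ¬ ∃ λ j → j < 3 + ν × E w (z (suc j))

    -- Every `z j` has a neighbour among `z 1`, ..., `z (3 + ν)`: its successor, or for the last one
    -- its predecessor.
    misses⇒≢ : ∀ {w} → Misses w → ∀ {j} → j ≤ 3 + ν → w ≢ z j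
    misses⇒≢ misses {j} j≤ refl with m≤n⇒m<n∨m≡n j≤
    ... | inj₁ j< = misses (j , j< , link Z j<)
    ... | inj₂ refl = misses (1 + ν , n≤1+n _ , E-sym (link Z ≤-refl))

    -- On the way from a to b, the vertex π is the first one with a neighbour among z 1, …, b, and e precedes it.
    meet : ∀ {e π} → U e → U π → E e π → E e α → E π α → ¬ E e x → ¬ E π x → Misses e →
      ∀ {j} → 2 ≤ j → j ≤ 3 + ν → E π (z j) → ⊥
    meet _ _ _ _ _ _ _ _ {suc zero} (s≤s ())
    meet {e} {π} e∈ π∈ e~π e~α π~α e≁x π≁x e-misses {suc (suc j)} _ j≤ π~z with E? π (z (3 + ν))
    -- `α` sees the start of `z`, `π` its end, and `e` is attached to both.
    ... | yes π~b = OnPath.sun Z (λ _ → z∈U) α∈ π∈ e∈ (E-sym π~α) e~α e~π e≁z (α~z (s≤s z≤n)) α≁end π≁start π~b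
      where
      e≁z : ∀ {l} → l ≤ 3 + ν → ¬ E e (z l)
      e≁z {zero} _ f = e≁x (subst (E e) z-start f)
      e≁z {suc l} l≤ f = e-misses (l , l≤ , f)
      π≁start : ¬ E π (z 0)
      π≁start f = π≁x (subst (E π) z-start f)
    ... | no π≁b = go (m≤n⇒m<n∨m≡n j≤)
      where
      e≁z : ∀ {l} → l ≤ 3 + ν → ¬ E e (z l)
      e≁z {zero} _ f = e≁x (subst (E e) z-start f)
      e≁z {suc l} l≤ f = e-misses (l , l≤ , f)
      π≁start : ¬ E π (z 0)
      π≁start f = π≁x (subst (E π) z-start f)
      -- Since `e` hangs at `π` and misses `z`, the neighbour `z (2 + j)` of `π` has no neighbour of
      -- `π` next to it.
      run-at : ∀ {i} → i < 3 + ν → E π (z i) → E π (z (suc i)) → ⊥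
      run-at = OnPath.run Z (λ _ → z∈U) π∈ e∈ (E-sym e~π) e≁z π≁start π≁b
      go : 2 + j < 3 + ν ⊎ 2 + j ≡ 3 + ν → ⊥
      go (inj₂ refl) = π≁b π~z
      go (inj₁ j<) = go′ (m≤n⇒m<n∨m≡n j<)
        where
        π≁₁ : ¬ E π (z (1 + j))
        π≁₁ f = run-at (<⇒≤ j<) f π~z
        π≁₃ : ¬ E π (z (3 + j))
        π≁₃ f = run-at j< π~z f
        π≁₀ : ¬ E π (z j)
        π≁₀ f = π≁₁ (E-sym (square z∈U z∈U z∈U π∈ (E-sym (link Z (<⇒≤ j<))) (E-sym (link Z (<⇒≤ (<⇒≤ j<)))) (E-sym f) π~z
          (λ eq → dist Z (n≤1+n _) (<⇒≤ j<) (sym eq)) (λ eq → π≁b′ eq) (far′ Z ≤-refl (<⇒≤ j<))))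
          where
          π≁b′ : z (1 + j) ≢ π
          π≁b′ eq = e-misses (j , <⇒≤ (<⇒≤ j<) , subst (E e) (sym eq) e~π)
        go′ : 3 + j < 3 + ν ⊎ 3 + j ≡ 3 + ν → ⊥
        -- The centre is `z (2 + j)`, with `π`, `e` as the third leg.
        go′ (inj₁ j<′) = no-longClaw (longClaw-copy (sub-path Z j j<′) (λ _ → z∈U) π∈ e∈
          π~z π≁₀ π≁₁ π≁₃ π≁₄ (E-sym e~π) (λ l≤ → e≁z (≤-trans (+-monoˡ-≤ j l≤) j<′)))
          where
          π≁₄ : ¬ E π (z (4 + j))
          π≁₄ f = π≁₃ (E-sym (square z∈U z∈U z∈U π∈ (link Z j<) (link Z j<′) (E-sym f) π~z
            (dist Z (n≤1+n _) j<′) (λ eq → e-misses (2 + j , <⇒≤ j<′ , subst (E e) (sym eq) e~π)) (far Z ≤-refl j<′)))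
        -- Here `z (2 + j)` is the last vertex before `b`. It is the middle of the path `e`, `π`,
        -- `z (2 + j)`, `z (1 + j)`, `z j`, all of which `α` sees, and `b` hangs at it.
        go′ (inj₂ refl) = no-whippingTop (whippingTop-copy {U = U}
          (five-path e~π π~z (E-sym (link Z (n≤1+n _))) (E-sym (link Z (≤-trans (n≤1+n _) (n≤1+n _))))
            (e≁z (n≤1+n _)) (e≁z (≤-trans (n≤1+n _) (n≤1+n _))) (e≁z (m≤n+m j 3))
            π≁₁ π≁₀ (far′ Z ≤-refl (n≤1+n _)))
          five∈ α∈ z∈U α~ (¬E-sym α≁end) (E-sym (link Z ≤-refl)) (¬E-sym (e≁z ≤-refl)) (¬E-sym π≁b)
          (far′ Z ≤-refl ≤-refl) (far′ Z (n≤1+n _) ≤-refl))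
          where
          five∈ : ∀ {i} → i ≤ 4 → U (five e π (z (2 + j)) (z (1 + j)) (z j) i)
          five∈ {0} _ = e∈
          five∈ {1} _ = π∈
          five∈ {2} _ = z∈U
          five∈ {3} _ = z∈U
          five∈ {suc (suc (suc (suc _)))} _ = z∈U
          α~ : ∀ {i} → i ≤ 4 → E α (five e π (z (2 + j)) (z (1 + j)) (z j) i)
          α~ {0} _ = E-sym e~α
          α~ {1} _ = E-sym π~α
          α~ {2} _ = α~z ≤-refl
          α~ {3} _ = α~z (n≤1+n _)
          α~ {suc (suc (suc (suc _)))} _ = α~z (≤-trans (n≤1+n _) (n≤1+n _))

    z-walk : ∀ {S i} → i ≤ 3 + ν → (∀ {j} → i ≤ j → j ≤ 3 + ν → S (z j)) → Walk S b (z i) _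
    z-walk {S} {i} i≤ h = reverse E-sym (subst (λ v → Walk S (z i) v (3 + ν ∸ i)) z-end
      (segment z i≤ (λ _ → h) (λ _ _ l< → link Z l<)))

    -- On a shortest path from `a` to `b` away from `x`, let `π` be the first vertex with a
    -- neighbour among `z 1`, ..., `b`. A neighbour beyond `z 1` is excluded by `meet`; if `β` is
    -- the only one, `β` also sees the vertex after `π`, and `run` gives a dagger.
    broom : ⊥
    broom = by-shortest a-b λ { {N} (p , p0 , pN , p∈ , P) → sweep p p0 pN p∈ P }
      where
      sweep : ∀ {N} p → p 0 ≡ a → p N ≡ b → (∀ l → Away x (p l)) → IPath p N → ⊥
      sweep {N} p refl pN p∈ P with ascend {Q = Misses ∘ p} (λ l → ¬? (anyUpTo? (λ j → E? (p l) (z (suc j))) (3 + ν)))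
          {0} {N} z≤n (λ (j , _ , e) → M.b≁y e) (λ m → m (1 + ν , n≤1+n _ , subst (λ v → E v (z (2 + ν))) (sym pN) (M.a~y refl)))
      ... | i , _ , i<N , ¬misses , misses = decide
        where
        p∈U : ∀ {l} → l ≤ N → U (p l)
        p∈U _ = proj₁ (p∈ _)
        α≢p : ∀ {l} → α ≢ p l
        α≢p {l} eq = proj₂ (proj₂ (p∈ l)) (subst (E x) eq x~α)
        β≢p : ∀ {l} → β ≢ p l
        β≢p {l} eq = proj₂ (proj₂ (p∈ l)) (subst (E x) eq x~β)
        -- Adjacency to `α` spreads by `bridge`: the path continues to `b`, and `z` leads from there
        -- back to the neighbour `β` of `α`.
        α~p : ∀ {l} → l ≤ suc i → E α (p l)
        α~p {zero} _ = E-sym a~α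
        α~p {suc l} (s≤s l≤i) = OnPath.bridge P p∈U α∈ (≤-trans (s≤s l≤i) i<N) ≤-refl (α~p (m≤n⇒m≤1+n l≤i)) (λ _ _ → α≢p)
          (λ ¬e → subst (λ v → Walk (Apart (p l) α) v β _) (sym pN) (z-walk {i = 1} (s≤s z≤n) λ {j} 1≤j j≤ →
            z∈U , (λ eq → misses⇒≢ (misses z≤n l≤i) j≤ (sym eq)) , z≢α 1≤j j≤ , λ (e , _) → apart 1≤j j≤ e))
          (E-sym (α~z (s≤s (s≤s z≤n))))
          where
          apart : ∀ {j} → 1 ≤ j → j ≤ 3 + ν → ¬ E (p l) (z j)
          apart {suc j} _ j≤ e = misses z≤n l≤i (j , j≤ , e)
        π : V
        π = p (suc i)
        β≁b : ¬ E β b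
        β≁b e = far Z (s≤s (s≤s (s≤s z≤n))) ≤-refl (subst (E β) (sym z-end) e)
        decide : ⊥
        decide with anyUpTo? (λ j → E? π (z (2 + j))) (2 + ν)
        ... | yes (j , j< , e) = meet (proj₁ (p∈ i)) (proj₁ (p∈ (suc i))) (link P i<N) (E-sym (α~p (n≤1+n _))) (E-sym (α~p ≤-refl))
          (¬E-sym (proj₂ (proj₂ (p∈ i)))) (¬E-sym (proj₂ (proj₂ (p∈ (suc i))))) (misses z≤n ≤-refl) {2 + j} (s≤s (s≤s z≤n)) (s≤s j<) e
        ... | no none = OnPath.run P p∈U z∈U x∈ (E-sym x~β) (λ _ → proj₂ (proj₂ (p∈ _)))
          (¬E-sym M.b≁y) (subst (λ v → ¬ E β v) (sym pN) β≁b) si<N (E-sym π~β) β~next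
          where
          π≁z : ∀ {j} → 2 ≤ j → j ≤ 3 + ν → ¬ E π (z j)
          π≁z {suc zero} (s≤s ())
          π≁z {suc (suc j)} _ (s≤s j≤) e = none (j , j≤ , e)
          π~β : E π β
          π~β = E-stable λ ¬e → ¬misses λ { (zero , _ , e) → ¬e e ; (suc j , j< , e) → π≁z (s≤s (s≤s z≤n)) j< e }
          si<N : suc i < N
          si<N with m≤n⇒m<n∨m≡n i<N
          ... | inj₁ h = h
          ... | inj₂ refl = ⊥-elim (β≁b (subst (E β) pN (E-sym π~β)))
          π≢z : ∀ {j} → 2 ≤ j → j ≤ 3 + ν → π ≢ z j
          π≢z {suc zero} (s≤s ())
          π≢z {suc (suc j)} _ j≤ eq = misses z≤n ≤-refl (suc j , j≤ , subst (E (p i)) eq (link P i<N))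
          -- The detour would run along the path to `b` and back along `z` to the neighbour `z 2` of
          -- `β`.
          β~next : E β (p (2 + i))
          β~next = OnPath.bridge P p∈U z∈U si<N ≤-refl (E-sym π~β) (λ _ _ → β≢p)
            (λ _ → subst (λ v → Walk (Apart π β) v (z 2) _) (sym pN) (z-walk {i = 2} (s≤s (s≤s z≤n)) λ 2≤j j≤ →
              z∈U , (λ eq → π≢z 2≤j j≤ (sym eq)) , (λ eq → dist Z 2≤j j≤ (sym eq)) , λ (e , _) → π≁z 2≤j j≤ e))
            (E-sym (link Z (s≤s (s≤s z≤n))))

  no-triple : ∀ {x a b m m′} → ¬ Triple x a b m m′
  no-triple {m = m} {m′} t = go m m′ (Facts.2≤m t) (Facts.2≤m (mirror t)) t
    where
    go : ∀ m m′ → 2 ≤ m → 2 ≤ m′ → ∀ {x a b} → ¬ Triple x a b m m′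
    go (suc zero) _ (s≤s ())
    go (suc (suc _)) (suc zero) _ (s≤s ())
    go 2 2 _ _ t = short-short t
    go 2 (suc (suc (suc _))) _ _ t = Broom.broom t
    go (suc (suc (suc _))) 2 _ _ t = Broom.broom (mirror t)
    go (suc (suc (suc _))) (suc (suc (suc _))) _ _ t = long-long t

  -- Induction on the total length of the two walks from `x`; the induction hypothesis is the
  -- minimality recorded in `Triple`.
  no-asteroidal : ∀ {x a b} → Conn (Away b) x a → Conn (Away a) x b → ¬ Conn (Away x) a b
  no-asteroidal {x} (m , w) (m′ , w′) = go _ (<-wellFounded (m + m′)) w w′ {refl}
    where
    go : ∀ s → Acc _<_ s → ∀ {a b m m′} → Walk (Away b) x a m → Walk (Away a) x b m′ → {eq : s ≡ m + m′} → ¬ Conn (Away x) a b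
    go s (acc rec) {m = m} {m′} w w′ {refl} ab
      with shortest w (λ l<m v → go _ (rec (+-monoˡ-< m′ l<m)) v w′ {refl} ab)
         | shortest w′ (λ l<m v → go _ (rec (+-monoʳ-< m l<m)) w v {refl} ab)
    ... | y , y0 , ym , y∈ , Y | z , z0 , zm , z∈ , Z = no-triple record
      { y = y ; z = z ; Y = Y ; Z = Z ; y-start = y0 ; z-start = z0 ; y-end = ym ; z-end = zm ; y∈ = y∈ ; z∈ = z∈
      ; a-b = ab ; smaller = λ h v v′ → go _ (rec h) v v′ {refl} }

  open Reachability G

  -- Interval models

  Off : (V → Set) → V → V → Set
  Off H c z = H z × z ≢ c × ¬ E c z

  Reach : (H K : V → Set) → V → V → Set
  Reach H K b a = ∃ λ k → K k × Conn (Off H b) k a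

  -- `meets` gives one of the two inequalities, the other follows by exchanging `x` and `y`. The
  -- strict bound `M` is where a further model can be appended.
  record Model (H K : V → Set) : Set where
    field
      l r : V → ℕ
      M : ℕ
      l≤r : ∀ {x} → H x → l x ≤ r x
      r<M : ∀ {x} → H x → r x < M
      meets : ∀ {x y} → H x → H y → E x y → l x ≤ r y
      overlap⇒E : ∀ {x y} → H x → H y → x ≢ y → l x ≤ r y → l y ≤ r x → E x y
      leftmost : ∀ {x} → K x → l x ≡ 0

  Clique : (V → Set) → Set
  Clique K = ∀ {x y} → K x → K y → x ≢ y → E x y

  -- A necessary condition for a model with `K` at the left end: of two disjoint intervals, the one
  -- further left blocks every path from that end to the other.
  NoReach : (H K : V → Set) → Set
  NoReach H K = ∀ {a b} → Reach H K b a → ¬ Reach H K a b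

  module _ {H K : V → Set} (H? : Decidable H) (K? : Decidable K) where

    off? : ∀ c → Decidable (Off H c)
    off? c z = H? z ×-dec (¬? (z Fin.≟ c) ×-dec ¬? (E? c z))

    reach? : ∀ b → Decidable (Reach H K b)
    reach? b a = Fin.any? (λ k → K? k ×-dec conn? (off? b) k a)

  clique-model : ∀ {H K} → Clique H → Model H K
  clique-model clique = record
    { l = λ _ → 0 ; r = λ _ → 0 ; M = 1 ; l≤r = λ _ → z≤n ; r<M = λ _ → s≤s z≤n ; meets = λ _ _ _ → z≤n
    ; overlap⇒E = λ x∈ y∈ x≢y _ _ → clique x∈ y∈ x≢y ; leftmost = λ _ → refl }

  -- One step of the recursion: splitting off a component.

  module Split {H K : V → Set} (H? : Decidable H) (K? : Decidable K) (H⊆U : ∀ {v} → H v → U v)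
    (K⊆H : ∀ {v} → K v → H v) (noReach : NoReach H K)
    {t : V} (t∈ : H t) (t-max : ∀ {r} → H r → ∃ (Off H r) → count (reach? H? K? r) ≤ count (reach? H? K? t))
    {x : V} (x∈ : Off H t x)
    (x-max : ∀ {r} → Off H t r → count (conn? (off? H? K? r) t) ≤ count (conn? (off? H? K? x) t)) where

    off-sym : ∀ {u v} → H u → Off H u v → Off H v u
    off-sym u∈ (_ , v≢u , u≁v) = u∈ , v≢u ∘ sym , ¬E-sym u≁v

    -- If K reached t past r, it would reach everything past r that it reaches past t, and t as well.
    unreached : ∀ {r} → Off H t r → ¬ Reach H K r t
    unreached {r} r∈ reach = <⇒≱ (count-< (reach? H? K? t) (reach? H? K? r) grow reach (λ (_ , _ , _ , w) → proj₁ (proj₂ (end∈ w)) refl))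
      (t-max (proj₁ r∈) (t , off-sym t∈ r∈))
      where
      -- A vertex on the walk that is `r` or adjacent to `r` would let `K` reach `r` past `t`, while
      -- by assumption it reaches `t` past `r`.
      grow : ∀ {v} → Reach H K t v → Reach H K r v
      grow (k , k∈ , _ , w) = k , k∈ , _ , relocate w λ (_ , w′) →
        proj₁ (end∈ w′) , (λ { refl → noReach reach (k , k∈ , _ , w′) }) ,
        λ e → noReach reach (k , k∈ , _ , snoc w′ (E-sym e) r∈)

    P Q R : V → Set
    P v = Conn (Off H x) t v
    Q v = H v × ¬ P v × ∃ λ p → P p × E p v
    R v = H v × ¬ P v × ¬ Q v

    P? : Decidable P
    P? = conn? (off? H? K? x) t

    Q? : Decidable Q
    Q? v = H? v ×-dec (¬? (P? v) ×-dec Fin.any? (λ p → P? p ×-dec E? p v))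

    R? : Decidable R
    R? v = H? v ×-dec (¬? (P? v) ×-dec ¬? (Q? v))

    P⊆ : ∀ {v} → P v → Off H x v
    P⊆ (_ , w) = end∈ w

    t∈P : P t
    t∈P = 0 , stop (off-sym t∈ x∈)

    -- A neighbour of `P` that `x` misses would itself belong to the component `P`.
    x~Q : ∀ {q} → Q q → E x q
    x~Q {q} (q∈ , ¬Pq , p , p∈@(_ , w) , p~q) = E-stable λ ¬e →
      ¬Pq (_ , snoc w p~q (q∈ , (λ { refl → proj₂ (proj₂ (P⊆ p∈)) (E-sym p~q) }) , ¬e))

    P≁R : ∀ {p r} → P p → R r → ¬ E p r
    P≁R p∈ (r∈ , ¬Pr , ¬Qr) e = ¬Qr (r∈ , ¬Pr , _ , p∈ , e)

    P-conn : ∀ {p p′} → P p → P p′ → Conn (λ v → P v) p p′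
    P-conn (_ , w) (_ , w′) = _ , reverse E-sym (relocate w (λ c → c)) ++ relocate w′ (λ c → c)

    -- If `q` and `q′` were not adjacent, `q′` followed by a path through `P`, which `x` misses,
    -- would be a detour around the edge from `x` to `q`.
    Q-clique : Clique Q
    Q-clique {q} {q′} Qq@(q∈ , ¬Pq , p , p∈ , p~q) Qq′@(q′∈ , ¬Pq′ , p′ , p′∈ , p′~q′) q≢q′ = E-stable λ ¬e →
      no-detour (H⊆U (proj₁ x∈)) (H⊆U q∈) (x~Q Qq) (x~Q Qq′)
        (step (H⊆U q′∈ , E⇒≢ (E-sym (x~Q Qq′)) , q≢q′ ∘ sym , λ (_ , e) → ¬e (E-sym e)) (E-sym p′~q′)
          (map-walk (λ {v} v∈ → let (h , v≢x , x≁v) = P⊆ v∈ in H⊆U h , v≢x , (λ { refl → ¬Pq v∈ }) , λ (e , _) → x≁v e)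
            (proj₂ (P-conn p′∈ p∈))))
        p~q

    -- If `r` missed `q`, then `r` in place of `x` would leave a component of `t` containing both
    -- `P` and `q`, against the choice of `x`.
    R~Q : ∀ {r q} → R r → Q q → E r q
    R~Q {r} {q} Rr@(r∈ , ¬Pr , ¬Qr) Qq@(q∈ , ¬Pq , p , (_ , w) , p~q) = E-stable λ ¬e →
      <⇒≱ (count-< P? (conn? (off? H? K? r) t) grow
            (_ , snoc (proj₂ (grow (_ , w))) p~q (q∈ , (λ { refl → ¬Qr Qq }) , ¬e)) ¬Pq)
          (x-max (r∈ , (λ { refl → ¬Pr t∈P }) , P≁R t∈P Rr))
      where
      grow : ∀ {v} → P v → Conn (Off H r) t v
      grow (_ , w) = _ , relocate w λ v∈ → proj₁ (P⊆ v∈) , (λ { refl → ¬Pr v∈ }) , λ e → P≁R v∈ Rr (E-sym e)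

    -- Inside `P` such a vertex would reach `t` past `x`.
    K∌P : ∀ {k} → K k → ¬ P k
    K∌P k∈ (_ , w) = unreached x∈ (_ , k∈ , _ , reverse E-sym w)

    R-noReach : NoReach R (λ v → K v × R v)
    R-noReach reach reach′ = noReach (wide reach) (wide reach′)
      where
      wide : ∀ {a b} → Reach R (λ v → K v × R v) b a → Reach H K b a
      wide (k , (k∈ , _) , _ , w) = k , k∈ , _ , map-walk (λ (v∈ , off) → proj₁ v∈ , off) w

    PQ : V → Set
    PQ v = P v ⊎ Q v

    PQ? : Decidable PQ
    PQ? v = P? v ⊎-dec Q? v

    PQ⊆H : ∀ {v} → PQ v → H v
    PQ⊆H (inj₁ v∈) = proj₁ (P⊆ v∈)
    PQ⊆H (inj₂ v∈) = proj₁ v∈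

    -- A violation would make a, b and x an asteroidal triple.
    PQ-noReach : NoReach PQ Q
    PQ-noReach {a} {b} reach@(_ , _ , _ , w) reach′@(_ , _ , _ , w′) =
      no-asteroidal (from-x b∈ reach) (from-x a∈ reach′)
        (_ , map-walk (λ v∈ → let (h , off) = P⊆ v∈ in H⊆U h , off) (proj₂ (P-conn a∈ b∈)))
      where
      -- Since `Q` is a clique, no walk starting in `Q` avoids the closed neighbourhood of a vertex
      -- of `Q`.
      in-P : ∀ {u v} → PQ v → Reach PQ Q v u → P v
      in-P (inj₁ v∈) _ = v∈
      in-P (inj₂ v∈) (q , q∈ , _ , w) = let (_ , q≢v , v≁q) = start∈ w in ⊥-elim (v≁q (Q-clique v∈ q∈ (q≢v ∘ sym)))
      a∈ : P a
      a∈ = in-P (proj₁ (end∈ w)) reach′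
      b∈ : P b
      b∈ = in-P (proj₁ (end∈ w′)) reach
      from-x : ∀ {u v} → P v → Reach PQ Q v u → Conn (Away v) x u
      from-x v∈ (q , q∈ , _ , w) = let (_ , v≢x , x≁v) = P⊆ v∈ in
        _ , step (H⊆U (proj₁ x∈) , v≢x ∘ sym , ¬E-sym x≁v) (x~Q q∈) (map-walk (λ (h , off) → H⊆U (PQ⊆H h) , off) w)

    R-smaller : count R? < count H?
    R-smaller = count-< R? H? proj₁ t∈ (λ (_ , ¬Pt , _) → ¬Pt t∈P)

    PQ-smaller : count PQ? < count H?
    PQ-smaller = count-< PQ? H? PQ⊆H (proj₁ x∈)
      λ { (inj₁ v∈) → proj₁ (proj₂ (P⊆ v∈)) refl ; (inj₂ v∈) → E-irrefl (x~Q v∈) }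

    data Side (v : V) : Set where
      in-R : R v → Side v
      in-Q : Q v → Side v
      in-P : P v → Side v

    side : ∀ {v} → H v → Side v
    side {v} v∈ with P? v | Q? v
    ... | yes p | _ = in-P p
    ... | no _ | yes q = in-Q q
    ... | no ¬p | no ¬q = in-R (v∈ , ¬p , ¬q)

    -- The intervals of Q start at 0 and run through the whole model of R into the model of P ∪ Q.
    glue : Model R (λ v → K v × R v) → Model PQ Q → Model H K
    glue A B = record
      { l = l ; r = r ; M = A.M + B.M ; l≤r = l≤r ; r<M = r<M ; meets = meets ; overlap⇒E = overlap⇒E ; leftmost = leftmost }
      where
      module A = Model A
      module B = Model B

      l r : V → ℕ
      l v with P? v | Q? v
      ... | yes _ | _ = A.M + B.l v
      ... | no _ | yes _ = 0
      ... | no _ | no _ = A.l v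
      r v with P? v | Q? v
      ... | yes _ | _ = A.M + B.r v
      ... | no _ | yes _ = A.M + B.r v
      ... | no _ | no _ = A.r v

      l-P : ∀ {v} → P v → l v ≡ A.M + B.l v
      l-P {v} p with P? v | Q? v
      ... | yes _ | _ = refl
      ... | no ¬p | _ = ⊥-elim (¬p p)
      r-P : ∀ {v} → P v → r v ≡ A.M + B.r v
      r-P {v} p with P? v | Q? v
      ... | yes _ | _ = refl
      ... | no ¬p | _ = ⊥-elim (¬p p)
      l-Q : ∀ {v} → Q v → l v ≡ 0
      l-Q {v} q with P? v | Q? v
      ... | yes p | _ = ⊥-elim (proj₁ (proj₂ q) p)
      ... | no _ | yes _ = refl
      ... | no _ | no ¬q = ⊥-elim (¬q q)
      r-Q : ∀ {v} → Q v → r v ≡ A.M + B.r v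
      r-Q {v} q with P? v | Q? v
      ... | yes _ | _ = refl
      ... | no _ | yes _ = refl
      ... | no _ | no ¬q = ⊥-elim (¬q q)
      l-R : ∀ {v} → R v → l v ≡ A.l v
      l-R {v} (_ , ¬p , ¬q) with P? v | Q? v
      ... | yes p | _ = ⊥-elim (¬p p)
      ... | no _ | yes q = ⊥-elim (¬q q)
      ... | no _ | no _ = refl
      r-R : ∀ {v} → R v → r v ≡ A.r v
      r-R {v} (_ , ¬p , ¬q) with P? v | Q? v
      ... | yes p | _ = ⊥-elim (¬p p)
      ... | no _ | yes q = ⊥-elim (¬q q)
      ... | no _ | no _ = refl

      l≤r : ∀ {v} → H v → l v ≤ r v
      l≤r v∈ with side v∈
      ... | in-P p rewrite l-P p | r-P p = +-monoʳ-≤ A.M (B.l≤r (inj₁ p))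
      ... | in-Q q rewrite l-Q q = z≤n
      ... | in-R h rewrite l-R h | r-R h = A.l≤r h

      r<M : ∀ {v} → H v → r v < A.M + B.M
      r<M v∈ with side v∈
      ... | in-P p rewrite r-P p = +-monoʳ-< A.M (B.r<M (inj₁ p))
      ... | in-Q q rewrite r-Q q = +-monoʳ-< A.M (B.r<M (inj₂ q))
      ... | in-R h rewrite r-R h = ≤-trans (A.r<M h) (m≤m+n _ _)

      meets : ∀ {u v} → H u → H v → E u v → l u ≤ r v
      meets u∈ v∈ e with side u∈ | side v∈
      ... | in-Q q | _ rewrite l-Q q = z≤n
      ... | in-P p | in-P p′ rewrite l-P p | r-P p′ = +-monoʳ-≤ A.M (B.meets (inj₁ p) (inj₁ p′) e)
      ... | in-P p | in-Q q rewrite l-P p | r-Q q = +-monoʳ-≤ A.M (B.meets (inj₁ p) (inj₂ q) e)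
      ... | in-P p | in-R h = ⊥-elim (P≁R p h e)
      ... | in-R h | in-P p = ⊥-elim (P≁R p h (E-sym e))
      -- Intervals of `R` start before `A.M`, and those of `Q` extend at least to `A.M`.
      ... | in-R h | in-Q q rewrite l-R h | r-Q q = ≤-trans (≤-trans (A.l≤r h) (<⇒≤ (A.r<M h))) (m≤m+n _ _)
      ... | in-R h | in-R h′ rewrite l-R h | r-R h′ = A.meets h h′ e

      overlap⇒E : ∀ {u v} → H u → H v → u ≢ v → l u ≤ r v → l v ≤ r u → E u v
      overlap⇒E u∈ v∈ u≢v h₁ h₂ with side u∈ | side v∈
      ... | in-Q q | in-Q q′ = Q-clique q q′ u≢v
      ... | in-Q q | in-R h = E-sym (R~Q h q)
      ... | in-R h | in-Q q = R~Q h q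
      ... | in-R h | in-R h′ rewrite l-R h | r-R h | l-R h′ | r-R h′ = A.overlap⇒E h h′ u≢v h₁ h₂
      ... | in-P p | in-P p′ rewrite l-P p | r-P p | l-P p′ | r-P p′ =
        B.overlap⇒E (inj₁ p) (inj₁ p′) u≢v (+-cancelˡ-≤ A.M _ _ h₁) (+-cancelˡ-≤ A.M _ _ h₂)
      ... | in-P p | in-R h rewrite l-P p | r-R h = ⊥-elim (<⇒≱ (A.r<M h) (≤-trans (m≤m+n _ _) h₁))
      ... | in-R h | in-P p rewrite l-P p | r-R h = ⊥-elim (<⇒≱ (A.r<M h) (≤-trans (m≤m+n _ _) h₂))
      -- The glued interval of `q` starts at 0; inside `B` its left end is again 0, by `leftmost`.
      ... | in-P p | in-Q q rewrite l-P p | r-Q q =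
        B.overlap⇒E (inj₁ p) (inj₂ q) u≢v (+-cancelˡ-≤ A.M _ _ h₁) (≤-trans (≤-reflexive (B.leftmost q)) z≤n)
      ... | in-Q q | in-P p rewrite l-P p | r-Q q =
        B.overlap⇒E (inj₂ q) (inj₁ p) u≢v (≤-trans (≤-reflexive (B.leftmost q)) z≤n) (+-cancelˡ-≤ A.M _ _ h₂)

      leftmost : ∀ {v} → K v → l v ≡ 0
      leftmost k∈ with side (K⊆H k∈)
      ... | in-P p = ⊥-elim (K∌P k∈ p)
      ... | in-Q q = l-Q q
      ... | in-R h = trans (l-R h) (A.leftmost (k∈ , h))

  model : ∀ {H K} (H? : Decidable H) (K? : Decidable K) → Acc _<_ (count H?) → (∀ {v} → H v → U v) →
    (∀ {v} → K v → H v) → NoReach H K → Model H K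
  model {H} {K} H? K? (acc rec) H⊆U K⊆H noReach
    with Fin.any? (λ t → H? t ×-dec Fin.any? (off? H? K? t))
  ... | no none = clique-model λ u∈ v∈ u≢v → E-stable λ ¬e → none (_ , u∈ , _ , v∈ , u≢v ∘ sym , ¬e)
  ... | yes (t₀ , t₀∈) with maximum (λ t → H? t ×-dec Fin.any? (off? H? K? t)) (λ t → count (reach? H? K? t)) (λ t → count≤n (reach? H? K? t)) t₀∈
  ... | t , (t∈ , x₀ , x₀∈) , t-max
    with maximum (off? H? K? t) (λ x → count (conn? (off? H? K? x) t)) (λ x → count≤n (conn? (off? H? K? x) t)) x₀∈
  ... | x , x∈ , x-max = glue
      (model R? (λ v → K? v ×-dec R? v) (rec R-smaller) (λ (v∈ , _) → H⊆U v∈) proj₂ R-noReach)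
      (model PQ? Q? (rec PQ-smaller) (λ v∈ → H⊆U (PQ⊆H v∈)) inj₂ PQ-noReach)
    where open Split H? K? H⊆U K⊆H noReach t∈ (λ r∈ off → t-max (r∈ , off)) x∈ x-max

  -- With `K` empty, `NoReach` holds vacuously.
  U-model : Decidable U → Model U (λ _ → ⊥)
  U-model U? = model U? (λ _ → no λ ()) (<-wellFounded _) (λ v∈ → v∈) ⊥-elim (λ ())

-- The forbidden graphs are not interval graphs

module IntervalModel {W : Set} (F : Graph W) (I : IsInterval F) where

  E : W → W → Set
  E t t′ = adj F t t′ ≡ true

  open Walks E public

  L R : W → ℕ
  L t = toℕ (proj₁ (proj₂ I) t)
  R t = toℕ (proj₁ (proj₂ (proj₂ I)) t)

  L≤R : ∀ t → L t ≤ R t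
  L≤R = proj₁ (proj₂ (proj₂ (proj₂ I)))

  adj⇔ : ∀ t t′ → t ≢ t′ → E t t′ ⇔ (L t ≤ R t′ × L t′ ≤ R t)
  adj⇔ = proj₂ (proj₂ (proj₂ (proj₂ I)))

  E-sym : ∀ {t t′} → E t t′ → E t′ t
  E-sym {t} {t′} e = trans (Graph.sym F t′ t) e

  meet : ∀ {t t′} → E t t′ → L t ≤ R t′
  meet {t} {t′} e = proj₁ (Equivalence.to (adj⇔ t t′ (λ { refl → T≢F e (irrefl F t) })) e)

  Avoid : W → W → Set
  Avoid c t = t ≢ c × adj F t c ≡ false

  sides : ∀ {c t} → Avoid c t → R t < L c ⊎ R c < L t
  sides {c} {t} (t≢c , ¬e) with L t ≤? R c | L c ≤? R t
  ... | no h | _ = inj₂ (≰⇒> h)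
  ... | yes _ | no h = inj₁ (≰⇒> h)
  ... | yes h | yes h′ = ⊥-elim (T≢F (Equivalence.from (adj⇔ t c t≢c) (h , h′)) ¬e)

  clash : ∀ {t t′} → R t < L t′ → ¬ R t′ < L t
  clash {t} {t′} h h′ = <-irrefl refl (<-trans (≤-trans h (L≤R t′)) (≤-trans h′ (L≤R t)))

  -- An interval to the left of `c` does not meet one to its right, so no step of the walk changes
  -- sides.
  left : ∀ {c t t′ k} → Walk (Avoid c) t t′ k → R t < L c → R t′ < L c
  left (stop _) h = h
  left {c} (step _ e w) h with sides (start∈ w)
  ... | inj₁ h′ = left w h′
  ... | inj₂ h′ = ⊥-elim (<⇒≱ (≤-trans h (≤-trans (L≤R c) (<⇒≤ h′))) (meet (E-sym e)))

  right : ∀ {c t t′ k} → Walk (Avoid c) t t′ k → R c < L t → R c < L t′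
  right w h with sides (end∈ w)
  ... | inj₁ h′ = ⊥-elim (clash h (left (reverse E-sym w) h′))
  ... | inj₂ h′ = h′

  -- If `t₁` lies between the other two, the walk joining them cannot pass it. If both lie on the
  -- same side of `t₁`, the walks from `t₁` would put each of them beyond the other.
  no-asteroidal : ∀ {t₁ t₂ t₃} → Conn (Avoid t₃) t₁ t₂ → Conn (Avoid t₁) t₂ t₃ → ¬ Conn (Avoid t₂) t₁ t₃
  no-asteroidal (_ , w₁₂) (_ , w₂₃) (_ , w₁₃) with sides (start∈ w₁₂) | sides (start∈ w₁₃)
  ... | inj₁ h | inj₁ h′ = clash (left w₁₂ h) (left w₁₃ h′)
  ... | inj₁ h | inj₂ h′ = clash h (left w₂₃ h′)
  ... | inj₂ h | inj₁ h′ = clash h (right w₂₃ h′)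
  ... | inj₂ h | inj₂ h′ = clash (right w₁₂ h) (right w₁₃ h′)

longClaw-not-interval : ¬ IsInterval longClaw
longClaw-not-interval I = no-asteroidal {LCV.b zero} {LCV.b (suc zero)} {LCV.b (suc (suc zero))}
  (_ , step {b = LCV.a zero} ((λ ()) , refl) refl (step {b = LCV.c} ((λ ()) , refl) refl (step {b = LCV.a (suc zero)} ((λ ()) , refl) refl
    (step {b = LCV.b (suc zero)} ((λ ()) , refl) refl (stop ((λ ()) , refl))))))
  (_ , step {b = LCV.a (suc zero)} ((λ ()) , refl) refl (step {b = LCV.c} ((λ ()) , refl) refl (step {b = LCV.a (suc (suc zero))} ((λ ()) , refl) refl
    (step {b = LCV.b (suc (suc zero))} ((λ ()) , refl) refl (stop ((λ ()) , refl))))))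
  (_ , step {b = LCV.a zero} ((λ ()) , refl) refl (step {b = LCV.c} ((λ ()) , refl) refl (step {b = LCV.a (suc (suc zero))} ((λ ()) , refl) refl
    (step {b = LCV.b (suc (suc zero))} ((λ ()) , refl) refl (stop ((λ ()) , refl))))))
  where
  open IntervalModel longClaw I

whippingTop-not-interval : ¬ IsInterval whippingTop
whippingTop-not-interval I = no-asteroidal {x₀} {x₄} {WTV.z}
  (_ , step {b = WTV.y} ((λ ()) , refl) refl (step {b = x₄} ((λ ()) , refl) refl (stop ((λ ()) , refl))))
  (_ , step {b = x₃} ((λ ()) , refl) refl (step {b = x₂} ((λ ()) , refl) refl (step {b = WTV.z} ((λ ()) , refl) refl (stop ((λ ()) , refl)))))
  (_ , step {b = x₁} ((λ ()) , refl) refl (step {b = x₂} ((λ ()) , refl) refl (step {b = WTV.z} ((λ ()) , refl) refl (stop ((λ ()) , refl)))))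
  where
  open IntervalModel whippingTop I
  x₀ x₁ x₂ x₃ x₄ : WTV
  x₀ = WTV.x zero
  x₁ = WTV.x (suc zero)
  x₂ = WTV.x (suc (suc zero))
  x₃ = WTV.x (suc (suc (suc zero)))
  x₄ = WTV.x (suc (suc (suc (suc zero))))

pathE-next : ∀ {k} (i : Fin k) → pathE (inject₁ i) (suc i) ≡ true
pathE-next i = ≡ᵇ-true {suc (toℕ (inject₁ i))} (cong suc (Fin.toℕ-inject₁ i))

dagger-not-interval : ∀ k → 2 ≤ k → ¬ IsInterval (dagger k)
dagger-not-interval (suc zero) (s≤s ())
dagger-not-interval (suc (suc κ)) _ I = no-asteroidal {DagV.p} {DagV.q} {DagV.s}
  (_ , step {b = first} ((λ ()) , refl) refl (snoc (proj₂ (along-v last′)) last~q ((λ ()) , refl)))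
  (_ , step {b = Defs.v last′} ((λ ()) , refl) q~last (step {b = DagV.c} ((λ ()) , refl) refl (step {b = DagV.s} ((λ ()) , refl) refl (stop ((λ ()) , refl)))))
  (_ , step {b = first} ((λ ()) , refl) refl (step {b = DagV.c} ((λ ()) , refl) refl (step {b = DagV.s} ((λ ()) , refl) refl (stop ((λ ()) , refl)))))
  where
  open IntervalModel (dagger (2 + κ)) I
  first : DagV (2 + κ)
  first = Defs.v zero
  last′ : Fin (2 + κ)
  last′ = fromℕ (suc κ)
  q~last : E DagV.q (Defs.v last′)
  q~last = cong (_∨ false) (≡ᵇ-true {suc (toℕ last′)} (cong suc (Fin.toℕ-fromℕ (suc κ))))
  last~q : E (Defs.v last′) DagV.q
  last~q = E-sym {DagV.q} {Defs.v last′} q~last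
  along-v : ∀ i → Conn (Avoid DagV.s) first (Defs.v i)
  along-v = <-weakInduction (λ i → Conn (Avoid DagV.s) first (Defs.v i)) (0 , stop ((λ ()) , refl))
    λ i (_ , w) → _ , snoc w (cong (_∨ pathE (suc i) (inject₁ i)) (pathE-next i)) ((λ ()) , refl)

ddagger-not-interval : ∀ k → 3 ≤ k → ¬ IsInterval (ddagger k)
ddagger-not-interval (suc zero) (s≤s ())
ddagger-not-interval (suc (suc zero)) (s≤s (s≤s ()))
ddagger-not-interval (suc (suc (suc κ))) _ I = no-asteroidal {first} {DDagV.x last′} {DDagV.w}
  (along-x last′)
  (_ , step {b = DDagV.v} ((λ ()) , refl) refl (step {b = DDagV.w} ((λ ()) , refl) refl (stop ((λ ()) , refl))))
  (_ , step {b = DDagV.u} ((λ ()) , refl) refl (step {b = DDagV.w} ((λ ()) , u≁last) refl (stop ((λ ()) , refl))))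
  where
  open IntervalModel (ddagger (3 + κ)) I
  first : DDagV (3 + κ)
  first = DDagV.x zero
  last′ : Fin (3 + κ)
  last′ = fromℕ (2 + κ)
  u≁last : adj (ddagger (3 + κ)) DDagV.u (DDagV.x last′) ≡ false
  u≁last = trans (cong (_∨ false) (<ᵇ-false (<-irrefl (cong suc (Fin.toℕ-fromℕ (2 + κ)))))) refl
  along-x : ∀ i → Conn (Avoid DDagV.w) first (DDagV.x i)
  along-x = <-weakInduction (λ i → Conn (Avoid DDagV.w) first (DDagV.x i)) (0 , stop ((λ ()) , refl))
    λ i (_ , w) → _ , snoc w (cong (_∨ pathE (suc i) (inject₁ i)) (pathE-next i)) ((λ ()) , refl)

-- The path from 3 to the last vertex stays on one side of the interval of 1, which bridges the gap between 0 and 2.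
cycle-not-interval : ∀ m (h : 4 ≤ m) → ¬ IsInterval (cycle m h)
cycle-not-interval (suc (suc (suc (suc κ)))) h@(s≤s (s≤s (s≤s (s≤s z≤n)))) I = go (sides {v₂} {v₀} ((λ ()) , refl))
  where
  open IntervalModel (cycle (4 + κ) h) I
  v₀ v₁ v₂ v₃ last′ : Fin (4 + κ)
  v₀ = zero
  v₁ = suc zero
  v₂ = suc (suc zero)
  v₃ = suc (suc (suc zero))
  last′ = suc (suc (suc (fromℕ κ)))
  v₀~last : E v₀ last′
  v₀~last = ≡ᵇ-true {toℕ (fromℕ κ)} (Fin.toℕ-fromℕ κ)
  around : ∀ i → Conn (Avoid v₁) v₃ (suc (suc (suc i)))
  around = <-weakInduction (λ i → Conn (Avoid v₁) v₃ (suc (suc (suc i)))) (0 , stop ((λ ()) , refl))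
    λ i (_ , w) → _ , snoc w (∨-introˡ (∨-introˡ (pathE-next i))) ((λ ()) , refl)
  arc : Walk (Avoid v₁) v₃ last′ _
  arc = proj₂ (around (fromℕ κ))
  go : R v₀ < L v₂ ⊎ R v₂ < L v₀ → ⊥
  go (inj₁ h) with sides {v₁} {v₃} ((λ ()) , refl)
  ... | inj₁ h′ = <⇒≱ (<-trans (≤-trans h′ (meet {v₁} {v₀} refl)) h) (meet {v₂} {v₃} refl)
  ... | inj₂ h′ = <⇒≱ (≤-trans h (≤-trans (meet {v₂} {v₁} refl) (<⇒≤ (right arc h′)))) (meet {last′} {v₀} (E-sym {v₀} {last′} v₀~last))
  go (inj₂ h) with sides {v₁} {v₃} ((λ ()) , refl)
  ... | inj₁ h′ = <⇒≱ (≤-trans (left arc h′) (≤-trans (meet {v₁} {v₂} refl) (<⇒≤ h))) (meet {v₀} {last′} v₀~last)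
  ... | inj₂ h′ = <⇒≱ (≤-trans h (≤-trans (meet {v₀} {v₁} refl) (<⇒≤ h′))) (meet {v₃} {v₂} refl)

-- Passing between balls, apex vertices and neighbourhoods.

contained⇒interval : ∀ {n W} (G : Graph (Fin n)) (F : Graph W) →
  ThreeLocallyInterval G → ContainsInduced G (apex F) → IsInterval F
contained⇒interval G F local (f , inj , match) =
  let (m , l , r , l≤r , adj⇔) = local (f nothing) in
  m , l ∘ pt , r ∘ pt , l≤r ∘ pt , λ t t′ t≢t′ → subst (λ b → b ≡ true ⇔ (toℕ (l (pt t)) ≤ toℕ (r (pt t′)) × toℕ (l (pt t′)) ≤ toℕ (r (pt t)))) (match (just t) (just t′))
    (adj⇔ (pt t) (pt t′) (λ eq → t≢t′ (just-injective (inj _ _ (cong proj₁ eq)))))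
  where
  -- The copy without its apex lies in the ball around the image of the apex, whose model is
  -- restricted to it.
  pt : _ → Σ _ (InBall G (f nothing))
  pt t = f (just t) , inj₂ (match nothing (just t))

copy⇒contained : ∀ {n W} (G : Graph (Fin n)) (F : Graph W) {v} →
  InGraph.Copy G (λ u → adj G v u ≡ true) F → ContainsInduced G (apex F)
copy⇒contained G F {v} (f , f∈ , inj , match) = f′ , inj′ , match′
  where
  open InGraph G
  f′ : Maybe _ → _
  f′ nothing = v
  f′ (just t) = f t
  inj′ : ∀ t t′ → f′ t ≡ f′ t′ → t ≡ t′
  inj′ nothing nothing _ = refl
  inj′ nothing (just t) eq = ⊥-elim (E⇒≢ (f∈ t) eq)
  inj′ (just t) nothing eq = ⊥-elim (E⇒≢ (f∈ t) (sym eq))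
  inj′ (just t) (just t′) eq = cong just (inj t t′ eq)
  match′ : ∀ t t′ → adj G (f′ t) (f′ t′) ≡ adj (apex F) t t′
  match′ nothing nothing = irrefl G v
  match′ nothing (just t) = f∈ t
  match′ (just t) nothing = E-sym (f∈ t)
  match′ (just t) (just t′) = match t t′

module BallModel {n : ℕ} (G : Graph (Fin n)) (v : Fin n) (l r : Fin n → ℕ) (M : ℕ) where

  open InGraph G

  module _ (l≤r : ∀ {u} → E v u → l u ≤ r u) (r<M : ∀ {u} → E v u → r u < M)
    (meets : ∀ {t u} → E v t → E v u → E t u → l t ≤ r u)
    (overlap⇒E : ∀ {t u} → E v t → E v u → t ≢ u → l t ≤ r u → l u ≤ r t → E t u) where

    private
      Pt : Set
      Pt = Σ (Fin n) (InBall G v)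

      -- The centre of the ball receives the whole path from 0 to `M`, so it meets every interval.
      λ′ ρ : Pt → ℕ
      λ′ (u , inj₁ _) = 0
      λ′ (u , inj₂ _) = l u
      ρ (u , inj₁ _) = M
      ρ (u , inj₂ _) = r u

      λ≤ρ : ∀ t → λ′ t ≤ ρ t
      λ≤ρ (_ , inj₁ _) = z≤n
      λ≤ρ (_ , inj₂ e) = l≤r e

      ρ≤M : ∀ t → ρ t ≤ M
      ρ≤M (_ , inj₁ _) = ≤-refl
      ρ≤M (_ , inj₂ e) = <⇒≤ (r<M e)

      λ≤M : ∀ t → λ′ t ≤ M
      λ≤M t = ≤-trans (λ≤ρ t) (ρ≤M t)

      L R : Pt → Fin (suc M)
      L t = fromℕ< (s≤s (λ≤M t))
      R t = fromℕ< (s≤s (ρ≤M t))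

      compare : ∀ t u → toℕ (L t) ≤ toℕ (R u) ⇔ λ′ t ≤ ρ u
      compare t u = mk⇔ (subst₂ _≤_ (Fin.toℕ-fromℕ< _) (Fin.toℕ-fromℕ< _))
        (subst₂ _≤_ (sym (Fin.toℕ-fromℕ< (s≤s (λ≤M t)))) (sym (Fin.toℕ-fromℕ< (s≤s (ρ≤M u)))))

      E⇒meets : ∀ t u → E (proj₁ t) (proj₁ u) → λ′ t ≤ ρ u
      E⇒meets (_ , inj₁ _) _ _ = z≤n
      E⇒meets t (_ , inj₁ _) _ = λ≤M t
      E⇒meets (_ , inj₂ e) (_ , inj₂ e′) f = meets e e′ f

      meets⇒E : ∀ t u → t ≢ u → λ′ t ≤ ρ u → λ′ u ≤ ρ t → E (proj₁ t) (proj₁ u)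
      meets⇒E (_ , inj₁ refl) (_ , inj₁ refl) t≢u _ _ = ⊥-elim (t≢u refl)
      meets⇒E (_ , inj₁ refl) (_ , inj₂ e) _ _ _ = e
      meets⇒E (_ , inj₂ e) (_ , inj₁ refl) _ _ _ = E-sym e
      -- Points of the ball carry a proof of membership; equal neighbours give equal points because
      -- equality proofs in `Bool` are unique.
      meets⇒E (t , inj₂ e) (u , inj₂ e′) t≢u h h′ = overlap⇒E e e′
        (λ { refl → t≢u (cong (λ p → t , inj₂ p) (Bool-irrelevant e e′)) }) h h′

    ball-interval : IsInterval (Ball G v)
    ball-interval = suc M , L , R , (λ t → Equivalence.from (compare t t) (λ≤ρ t)) , λ t u t≢u → mk⇔
      (λ e → Equivalence.from (compare t u) (E⇒meets t u e) , Equivalence.from (compare u t) (E⇒meets u t (E-sym e)))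
      (λ (h , h′) → meets⇒E t u t≢u (Equivalence.to (compare t u) h) (Equivalence.to (compare u t) h′))

theorem2 : ∀ (n : ℕ) (G : Graph (Fin n)) →
    ThreeLocallyInterval G ⇔
      (WheelFree G ×
       ¬ ContainsInduced G (apex longClaw) ×
       ¬ ContainsInduced G (apex whippingTop) ×
       (∀ k → 2 ≤ k → ¬ ContainsInduced G (apex (dagger k))) ×
       (∀ m → 3 ≤ m → ¬ ContainsInduced G (apex (ddagger m))))
theorem2 n G = mk⇔
  (λ local → (λ m h → cycle-not-interval m h ∘ contained⇒interval G _ local)
    , longClaw-not-interval ∘ contained⇒interval G _ local
    , whippingTop-not-interval ∘ contained⇒interval G _ local
    , (λ k h → dagger-not-interval k h ∘ contained⇒interval G _ local)
    , (λ k h → ddagger-not-interval k h ∘ contained⇒interval G _ local))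
  (λ (wheel-free , no-claw , no-top , no-dagger , no-ddagger) v →
    let
      open Local G (λ u → adj G v u ≡ true)
        (λ m h → wheel-free m h ∘ copy⇒contained G _) (no-claw ∘ copy⇒contained G _) (no-top ∘ copy⇒contained G _)
        (λ k h → no-dagger k h ∘ copy⇒contained G _) (λ k h → no-ddagger k h ∘ copy⇒contained G _)
      open Model (U-model (λ u → InGraph.E? G v u))
    in BallModel.ball-interval G v l r M l≤r r<M meets overlap⇒E)
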